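{- There exists a randomized algorithm which, given cut-query oracle access to an unweighted, undirected, simple graph $G=(V,E)$ on $n$ vertices and two distinct vertices $s,t\in V$, computes an exact minimum $s$-$t$ cut of $G$ with high probability using $\widetilde{O}(n^{5/3})$ oracle queries.
   Context: Cut-query oracle: on query $S\subseteq V$, the oracle returns $c(S)$, the number of edges of $G$ with exactly one endpoint in $S$. A minimum $s$-$t$ cut is a set $S\subseteq V$ with $s\in S$, $t\notin S$ minimizing $c(S)$. "With high probability" means with probability at least $1-n^{ -\Omega(1)}$. $\widetilde{O}(x)$ denotes $O(x\cdot\mathrm{polylog}(x))$. -}

module Defs where

open import Data.Nat using (ℕ; zero; suc; _+_; _*_; _∸_; _^_; _≤_; _<ᵇ_)
open import Data.Nat.Logarithm using (⌈log₂_⌉)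
open import Data.Bool using (Bool; true; false; if_then_else_; _∧_; _xor_)
open import Data.Fin using (Fin; toℕ)
open import Data.Fin.Subset using (Subset; _∈_; _∉_)
open import Data.Vec using (Vec; []; _∷_; lookup)
open import Data.Nat.ListAction using (sum)
open import Data.List using (List; []; _∷_; map; allFin; _++_; length)
open import Data.List.Relation.Unary.All using (All)
open import Data.List.Relation.Unary.Unique.Propositional using (Unique)
open import Data.Product using (Σ; Σ-syntax; ∃; ∃-syntax; _×_; _,_; proj₁; proj₂)
open import Relation.Binary.PropositionalEquality using (_≡_; _≢_)

record Graph (n : ℕ) : Set where
  field
    adj    : Fin n → Fin n → Bool
    sym    : ∀ i j → adj i j ≡ adj j i
    irrefl : ∀ i → adj i i ≡ false
open Graph public

cut : ∀ {n} → Graph n → Subset n → ℕ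
cut {n} G S = sum (map (λ i → sum (map (λ j → edgeCut i j) (allFin n))) (allFin n))
  where
  edgeCut : Fin n → Fin n → ℕ
  edgeCut i j =
    if (toℕ i <ᵇ toℕ j) ∧ adj G i j ∧ (lookup S i xor lookup S j) then 1 else 0

IsMinSTCut : ∀ {n} → Graph n → Fin n → Fin n → Subset n → Set
IsMinSTCut G s t S =
  s ∈ S × t ∉ S × (∀ S′ → s ∈ S′ → t ∉ S′ → cut G S ≤ cut G S′)

data QTree (n : ℕ) : Set where
  ask : Subset n → (ℕ → QTree n) → QTree n
  ret : Subset n → QTree n

run : ∀ {n} → QTree n → (Subset n → ℕ) → Subset n × ℕ
run (ret S)   O = S , 0
run (ask Q k) O with run (k (O Q)) O
... | S , c = S , suc c

cutOracle : ∀ {n} → Graph n → Subset n → ℕ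
cutOracle G = cut G

-- A randomized cut-query algorithm: m n random bits on n-vertex inputs;
-- for each n, s, t and random string, a query decision tree.
Algorithm : (ℕ → ℕ) → Set
Algorithm m = (n : ℕ) → Fin n → Fin n → Vec Bool (m n) → QTree n

output : ∀ {m} → Algorithm m → ∀ {n} → Graph n → Fin n → Fin n → Vec Bool (m n) → Subset n
output A {n} G s t r = proj₁ (run (A n s t r) (cutOracle G))

queries : ∀ {m} → Algorithm m → ∀ {n} → Graph n → Fin n → Fin n → Vec Bool (m n) → ℕ
queries A {n} G s t r = proj₂ (run (A n s t r) (cutOracle G))

-- Query bound Õ(n^{5/3}) = O(n^{5/3} · log^k n), stated with cubes to stay in ℕ:
-- queries³ ≤ c · n⁵ · ⌈log₂ n⌉^k for all n ≥ N, all inputs, all random strings.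
QueryBound : ∀ {m} → Algorithm m → Set
QueryBound A =
  ∃[ c ] ∃[ k ] ∃[ N ] ∀ n → N ≤ n → (G : Graph n) → (s t : Fin n) → s ≢ t →
    (r : Vec Bool _) → queries A G s t r ^ 3 ≤ c * n ^ 5 * ⌈log₂ n ⌉ ^ k

-- Correct with high probability: failure probability ≤ n^{-p/q} (p, q ≥ 1),
-- for all n ≥ N: there is a duplicate-free list Good of random strings, on each
-- of which the output is a min s-t cut, with
--   ((2^m − |Good|) / 2^m)^q ≤ n^{-p}.
HighProbCorrect : ∀ {m} → Algorithm m → Set
HighProbCorrect {m} A =
  ∃[ p ] ∃[ q ] ∃[ N ] (1 ≤ p) × (1 ≤ q) ×
    (∀ n → N ≤ n → (G : Graph n) → (s t : Fin n) → s ≢ t →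
      Σ[ Good ∈ List (Vec Bool (m n)) ]
        Unique Good × All (λ r → IsMinSTCut G s t (output A G s t r)) Good ×
        ((2 ^ m n ∸ length Good) ^ q * n ^ p ≤ (2 ^ m n) ^ q))

{-# OPTIONS --safe #-}

-- The algorithm is deterministic (it uses no random bits) and combines two ways of learning edges, each
-- learned edge costing O(log n) queries: c(A) + c(B) - c(A ∪ B) = 2 e(A, B) for disjoint A and B, so three
-- queries decide whether some unknown edge joins A and B, and bisection then finds one.
--
-- Phase 1 is push-relabel with D = a² levels, a ≈ n^{1/3}, and a single active token. The token walks from s
-- along residual arcs that go down one level, its current vertex is raised when there is no such arc, and the
-- token is parked once it reaches t or level D. A potential argument bounds the number of steps by O(nD).
-- When s has reached level D, two consecutive levels contain at most 2a vertices in total, so the cut between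
-- them has residual capacity at most 2a²: the known subgraph K then carries a preflow into t whose value x is
-- within 2a² + 1 of the minimum cut of G.
--
-- Phase 2 repeatedly takes a minimum s-t cut T of the known graph and learns an unknown edge across T, until
-- there is none and T is a minimum cut of G. Every s-t cut of K has size at least x, so at most 2a² + 1 of the
-- edges learned in phase 2 cross T. A set of edges that can be built by adding each edge across a cut
-- with fewer than κ earlier edges has at most κ (|W| - 1) edges inside every nonempty W, hence phase 2 learns
-- O(a² n) edges.
module Submission where

open import Defs
open import Data.Nat
open import Data.Product using (Σ-syntax; ∃-syntax; _×_; _,_; proj₁; proj₂)
open import Data.Bool using (Bool; true; false; if_then_else_; _∧_; _∨_; not; _xor_)
import Data.Bool.Properties as Bool
open import Data.Empty using (⊥)
open import Data.Fin using (Fin; zero; suc; toℕ)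
import Data.Fin.Properties as Fin
open import Data.Fin.Subset using (Subset; _∈_; _∉_)
open import Data.Fin.Subset.Properties using (anySubset?)
open import Data.List as List using ()
open import Data.List.Properties using (map-tabulate)
open import Data.List.Relation.Unary.All as All using ()
open import Data.List.Relation.Unary.AllPairs as AllPairs using ()
open import Data.Maybe using (Maybe; just; nothing)
open import Data.Nat.Induction using (<-wellFounded)
import Data.Nat.ListAction as ListAction
open import Data.Nat.Logarithm using (⌈log₂_⌉; ⌈log₂⌉-mono-≤; ⌈log₂2^n⌉≡n)
open import Data.Nat.Logarithm.Core using (⌈log2⌉)
open import Data.Nat.Properties
open import Data.Nat.Tactic.RingSolver using (solve-∀)
open import Data.Sum using (_⊎_; inj₁; inj₂; [_,_]′)
open import Data.Unit using (⊤; tt)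
open import Data.Vec as Vec using (lookup; tabulate)
open import Data.Vec.Properties using (lookup∘tabulate; lookup⇒[]=; []=⇒lookup)
open import Function using (_∘_)
open import Induction.WellFounded using (Acc; acc)
open import Relation.Binary.PropositionalEquality renaming (sym to ≡-sym)
open import Relation.Nullary using (Dec; yes; no; does; ¬_; contradiction)
open import Relation.Nullary.Decidable using (_×-dec_; _⊎-dec_; dec-true; dec-false)
open import Algebra.Properties.Semiring.Sum +-*-semiring
  using (sum; sum-cong-≗; ∑-distrib-+; ∑-comm; *-distribˡ-sum; *-distribʳ-sum)

private variable
  n : ℕ
  X Y : Set

-- Sums over finite sets and cuts

sum-mono : {f g : Fin n → ℕ} → (∀ i → f i ≤ g i) → sum f ≤ sum g
sum-mono {zero}  f≤g = z≤n
sum-mono {suc n} f≤g = +-mono-≤ (f≤g zero) (sum-mono (f≤g ∘ suc))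

sum-const : ∀ n c → sum {n} (λ _ → c) ≡ n * c
sum-const zero    c = refl
sum-const (suc n) c = cong (c +_) (sum-const n c)

sum-bounded : ∀ {c} {f : Fin n → ℕ} → (∀ i → f i ≤ c) → sum f ≤ n * c
sum-bounded {n} {c} f≤c = ≤-trans (sum-mono f≤c) (≤-reflexive (sum-const n c))

sum-zero : {f : Fin n → ℕ} → (∀ i → f i ≡ 0) → sum f ≡ 0
sum-zero {n} f≡0 = trans (sum-cong-≗ f≡0) (trans (sum-const n 0) (*-zeroʳ n))

term≤sum : (f : Fin n → ℕ) → ∀ i → f i ≤ sum f
term≤sum f zero    = m≤m+n _ _
term≤sum f (suc i) = ≤-trans (term≤sum (f ∘ suc) i) (m≤n+m _ _)

sum-mono-< : {f g : Fin n → ℕ} → (∀ i → f i ≤ g i) → ∀ i → f i < g i → sum f < sum g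
sum-mono-< f≤g zero    f<g = +-mono-<-≤ f<g (sum-mono (f≤g ∘ suc))
sum-mono-< f≤g (suc i) f<g = +-mono-≤-< (f≤g zero) (sum-mono-< (f≤g ∘ suc) i f<g)

sum-<⇒∃< : (f g : Fin n → ℕ) → sum f < sum g → ∃[ i ] f i < g i
sum-<⇒∃< {suc n} f g lt with f zero <? g zero
... | yes p = zero , p
... | no ¬p with sum-<⇒∃< (f ∘ suc) (g ∘ suc)
                   (+-cancelˡ-< (g zero) _ _ (≤-<-trans (+-monoˡ-≤ _ (≮⇒≥ ¬p)) lt))
...   | i , q = suc i , q

pigeonhole-≤ : ∀ c (g : Fin n → ℕ) → 1 ≤ n → sum g ≤ n * c → ∃[ i ] g i ≤ c
pigeonhole-≤ {n} c g 1≤n bound with Fin.any? (λ i → g i ≤? c)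
... | yes p = p
... | no ¬p = contradiction bound (<⇒≱ (<-≤-trans
        (subst (n * c <_) (≡-sym (*-suc n c)) (m<n+m (n * c) 1≤n))
        (≤-trans (≤-reflexive (≡-sym (sum-const n (suc c))))
                 (sum-mono λ i → ≰⇒> (λ q → ¬p (i , q))))))

-- Adjacency, known edges and push counts are all such matrices. An undirected edge occupies both
-- `(i, j)` and `(j, i)`, while push counts need not be symmetric.
Matrix : ℕ → Set
Matrix n = Fin n → Fin n → ℕ

infixl 6 _⊞_
_⊞_ : Matrix n → Matrix n → Matrix n
(M ⊞ N) i j = M i j + N i j

total : Matrix n → ℕ
total M = sum λ i → sum λ j → M i j

total-cong : {M N : Matrix n} → (∀ i j → M i j ≡ N i j) → total M ≡ total N
total-cong M≡N = sum-cong-≗ λ i → sum-cong-≗ (M≡N i)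

total-mono : {M N : Matrix n} → (∀ i j → M i j ≤ N i j) → total M ≤ total N
total-mono M≤N = sum-mono λ i → sum-mono (M≤N i)

total-mono-< : {M N : Matrix n} → (∀ i j → M i j ≤ N i j) →
               ∀ i j → M i j < N i j → total M < total N
total-mono-< M≤N i j M<N = sum-mono-< (λ k → sum-mono (M≤N k)) i (sum-mono-< (M≤N i) j M<N)

total-<⇒∃< : (M N : Matrix n) → total M < total N → ∃[ i ] ∃[ j ] M i j < N i j
total-<⇒∃< M N lt with sum-<⇒∃< _ _ lt
... | i , lt′ with sum-<⇒∃< (M i) (N i) lt′
...   | j , p = i , j , p

total-+ : (M N : Matrix n) → total (M ⊞ N) ≡ total M + total N
total-+ M N = trans (sum-cong-≗ λ i → ∑-distrib-+ (M i) (N i))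
                    (∑-distrib-+ (λ i → sum (M i)) (λ i → sum (N i)))

total-* : (f g : Fin n → ℕ) → total (λ i j → f i * g j) ≡ sum f * sum g
total-* f g = trans (sum-cong-≗ λ i → ≡-sym (*-distribˡ-sum (f i) g))
                    (≡-sym (*-distribʳ-sum (sum g) f))

ι : Bool → ℕ
ι true  = 1
ι false = 0

single : Fin n → Fin n → Bool
single x i = does (i Fin.≟ x)

single-refl : (x : Fin n) → single x x ≡ true
single-refl x with x Fin.≟ x
... | yes _ = refl
... | no ¬p = contradiction refl ¬p

single⇒≡ : (x i : Fin n) → single x i ≡ true → i ≡ x
single⇒≡ x i p with i Fin.≟ x
... | yes q = q

single-≢ : {x i : Fin n} → i ≢ x → single x i ≡ false
single-≢ {x = x} {i} p with i Fin.≟ x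
... | yes q = contradiction q p
... | no _  = refl

sum-single : (x : Fin n) (g : Fin n → ℕ) → sum (λ i → ι (single x i) * g i) ≡ g x
sum-single {suc n} zero    g = trans (cong₂ _+_ (*-identityˡ (g zero)) (trans (sum-const n 0) (*-zeroʳ n))) (+-identityʳ _)
sum-single {suc n} (suc x) g = trans (sum-cong-≗ λ i → cong (λ b → ι b * g (suc i)) (step i))
                                     (sum-single x (g ∘ suc))
  where
  step : ∀ i → single (suc x) (suc i) ≡ single x i
  step i with i Fin.≟ x
  ... | yes _ = refl
  ... | no _  = refl

VertexSet : ℕ → Set
VertexSet n = Fin n → Bool

∁ : VertexSet n → VertexSet n
∁ A i = not (A i)

infixr 7 _∩_
infixr 6 _∪_
_∩_ _∪_ : VertexSet n → VertexSet n → VertexSet n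
(A ∩ B) i = A i ∧ B i
(A ∪ B) i = A i ∨ B i

∣_∣ₛ : VertexSet n → ℕ
∣ A ∣ₛ = sum (ι ∘ A)

unit : Fin n → Fin n → Matrix n
unit x y i j = ι (single x i) * ι (single y j)

arcs : Matrix n → VertexSet n → VertexSet n → ℕ
arcs M A B = total λ i j → ι (A i ∧ B j) * M i j

∂⁺ : Matrix n → VertexSet n → ℕ
∂⁺ M S = arcs M S (∁ S)

arcs-⊞ : (M N : Matrix n) (A B : VertexSet n) → arcs (M ⊞ N) A B ≡ arcs M A B + arcs N A B
arcs-⊞ M N A B = trans (total-cong λ i j → *-distribˡ-+ (ι (A i ∧ B j)) (M i j) (N i j))
                       (total-+ (λ i j → ι (A i ∧ B j) * M i j) (λ i j → ι (A i ∧ B j) * N i j))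

arcs-mono : {M N : Matrix n} → (∀ i j → M i j ≤ N i j) → ∀ A B → arcs M A B ≤ arcs N A B
arcs-mono M≤N A B = total-mono λ i j → *-monoʳ-≤ (ι (A i ∧ B j)) (M≤N i j)

arcs-zero : (A B : VertexSet n) → arcs (λ _ _ → 0) A B ≡ 0
arcs-zero A B = sum-zero λ i → sum-zero λ j → *-zeroʳ (ι (A i ∧ B j))

arcs-unit : (x y : Fin n) (A B : VertexSet n) → arcs (unit x y) A B ≡ ι (A x ∧ B y)
arcs-unit x y A B = begin
  total (λ i j → ι (A i ∧ B j) * (ι (single x i) * ι (single y j)))
    ≡⟨ sum-cong-≗ (λ i → trans
         (sum-cong-≗ λ j → rearrange (ι (A i ∧ B j)) (ι (single x i)) (ι (single y j)))
         (sum-single y (λ j → ι (single x i) * ι (A i ∧ B j)))) ⟩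
  sum (λ i → ι (single x i) * ι (A i ∧ B y))
    ≡⟨ sum-single x (λ i → ι (A i ∧ B y)) ⟩
  ι (A x ∧ B y) ∎
  where
  open ≡-Reasoning
  rearrange : ∀ a b c → a * (b * c) ≡ c * (b * a)
  rearrange = solve-∀

Symmetric : Matrix n → Set
Symmetric M = ∀ i j → M i j ≡ M j i

transpose-arcs : (M : Matrix n) (A B : VertexSet n) →
                 total (λ i j → ι (A i ∧ B j) * M j i) ≡ arcs M B A
transpose-arcs M A B = trans (∑-comm λ i j → ι (A i ∧ B j) * M j i)
  (total-cong λ j i → cong (λ b → ι b * M j i) (Bool.∧-comm (A i) (B j)))

arcs-sym : {M : Matrix n} → Symmetric M → ∀ A B → arcs M A B ≡ arcs M B A
arcs-sym {M = M} M-sym A B =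
  trans (total-cong λ i j → cong (ι (A i ∧ B j) *_) (M-sym i j)) (transpose-arcs M A B)

-- An edge between `A` and `B` leaves each of them but not their union, hence the factor 2; any
-- other edge counts equally on both sides.
∂⁺-disjoint-∪ : {M : Matrix n} → Symmetric M → ∀ A B → (∀ i → A i ∧ B i ≡ false) →
                ∂⁺ M A + ∂⁺ M B ≡ ∂⁺ M (A ∪ B) + 2 * arcs M A B
∂⁺-disjoint-∪ {n} {M} M-sym A B disjoint = begin
  ∂⁺ M A + ∂⁺ M B
    ≡⟨ total-+ (λ i j → ι (A i ∧ not (A j)) * M i j) (λ i j → ι (B i ∧ not (B j)) * M i j) ⟨
  total (λ i j → ι (A i ∧ not (A j)) * M i j + ι (B i ∧ not (B j)) * M i j)
    ≡⟨ total-cong (λ i j → pointwise (A i) (B i) (A j) (B j) (M i j) (disjoint i) (disjoint j)) ⟩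
  total (λ i j → ι ((A ∪ B) i ∧ not ((A ∪ B) j)) * M i j + (ι (A i ∧ B j) * M i j + ι (B i ∧ A j) * M i j))
    ≡⟨ trans (total-+ {n} _ _) (cong (∂⁺ M (A ∪ B) +_) (total-+ {n} _ _)) ⟩
  ∂⁺ M (A ∪ B) + (arcs M A B + arcs M B A)
    ≡⟨ cong (λ e → ∂⁺ M (A ∪ B) + (arcs M A B + e)) (trans (arcs-sym M-sym B A) (≡-sym (+-identityʳ _))) ⟩
  ∂⁺ M (A ∪ B) + 2 * arcs M A B ∎
  where
  open ≡-Reasoning
  pointwise : ∀ a b a′ b′ m → a ∧ b ≡ false → a′ ∧ b′ ≡ false →
    ι (a ∧ not a′) * m + ι (b ∧ not b′) * m
      ≡ ι ((a ∨ b) ∧ not (a′ ∨ b′)) * m + (ι (a ∧ b′) * m + ι (b ∧ a′) * m)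
  pointwise false false _ _ m _ _ = refl
  pointwise false true false false m _ _ = ≡-sym (+-identityʳ _)
  pointwise false true false true m _ _ = refl
  pointwise false true true false m _ _ = refl
  pointwise true false false false m _ _ = refl
  pointwise true false false true m _ _ = refl
  pointwise true false true false m _ _ = refl

-- Cut queries as sums over ordered pairs

listSum-allFin : (f : Fin n → ℕ) → ListAction.sum (List.map f (List.allFin n)) ≡ sum f
listSum-allFin f = trans (cong ListAction.sum (map-tabulate (λ i → i) f)) (go f)
  where
  go : ∀ {m} (g : Fin m → ℕ) → ListAction.sum (List.tabulate g) ≡ sum g
  go {zero}  g = refl
  go {suc m} g = cong (g zero +_) (go (g ∘ suc))

adjacency : Graph n → Matrix n
adjacency G i j = ι (adj G i j)

adjacency-sym : (G : Graph n) → Symmetric (adjacency G)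
adjacency-sym G i j = cong ι (Graph.sym G i j)

adjacency≤1 : (G : Graph n) → ∀ i j → adjacency G i j ≤ 1
adjacency≤1 G i j with adj G i j
... | true  = ≤-refl
... | false = z≤n

-- `cut` counts an edge once, with its smaller endpoint first. Transposing the terms whose larger
-- endpoint lies in `S` orients every crossing edge out of `S`; for distinct endpoints exactly one
-- of the two orders holds, and the diagonal contributes nothing.
cut≡∂⁺ : (G : Graph n) (S : Subset n) → cut G S ≡ ∂⁺ (adjacency G) (lookup S)
cut≡∂⁺ {n} G S = begin
  cut G S
    ≡⟨ trans (listSum-allFin {n} _) (sum-cong-≗ {n} λ i → listSum-allFin {n} _) ⟩
  total (λ i j → if (toℕ i <ᵇ toℕ j) ∧ adj G i j ∧ (L i xor L j) then 1 else 0)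
    ≡⟨ total-cong (λ i j → split (toℕ i <ᵇ toℕ j) (adj G i j) (L i) (L j)) ⟩
  total (λ i j → fwd i j + ι (not (L i) ∧ L j) * (ι (toℕ i <ᵇ toℕ j) * A i j))
    ≡⟨ total-+ fwd _ ⟩
  total fwd + total (λ i j → ι (not (L i) ∧ L j) * (ι (toℕ i <ᵇ toℕ j) * A i j))
    ≡⟨ cong (total fwd +_) (transpose-arcs (λ j i → ι (toℕ i <ᵇ toℕ j) * A i j) (∁ L) L) ⟩
  total fwd + arcs (λ j i → ι (toℕ i <ᵇ toℕ j) * A i j) L (∁ L)
    ≡⟨ total-+ fwd _ ⟨
  total (λ i j → fwd i j + ι (L i ∧ not (L j)) * (ι (toℕ j <ᵇ toℕ i) * A j i))
    ≡⟨ total-cong merge ⟩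
  ∂⁺ A L ∎
  where
  open ≡-Reasoning
  L = lookup S
  A = adjacency G
  fwd : Matrix n
  fwd i j = ι (L i ∧ not (L j)) * (ι (toℕ i <ᵇ toℕ j) * A i j)
  split : ∀ b a x y → (if b ∧ a ∧ (x xor y) then 1 else 0) ≡
          ι (x ∧ not y) * (ι b * ι a) + ι (not x ∧ y) * (ι b * ι a)
  split false a false false = refl
  split false a false true  = refl
  split false a true  false = refl
  split false a true  true  = refl
  split true a false false rewrite Bool.∧-zeroʳ a = refl
  split true false false true = refl
  split true true  false true = refl
  split true false true false = refl
  split true true  true false = refl
  split true a true true rewrite Bool.∧-zeroʳ a = refl
  one : ∀ i j → i ≢ j → ι (i <ᵇ j) + ι (j <ᵇ i) ≡ 1
  one zero    zero    p = contradiction refl p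
  one zero    (suc j) p = refl
  one (suc i) zero    p = refl
  one (suc i) (suc j) p = one i j (p ∘ cong suc)
  collect : ∀ x p q a → x * (p * a) + x * (q * a) ≡ x * ((p + q) * a)
  collect = solve-∀
  merge : ∀ i j → fwd i j + ι (L i ∧ not (L j)) * (ι (toℕ j <ᵇ toℕ i) * A j i)
                  ≡ ι (L i ∧ not (L j)) * A i j
  merge i j with i Fin.≟ j
  ... | yes refl rewrite Bool.∧-inverseʳ (L i) = refl
  ... | no i≢j rewrite adjacency-sym G j i =
    trans (collect (ι (L i ∧ not (L j))) (ι (toℕ i <ᵇ toℕ j)) (ι (toℕ j <ᵇ toℕ i)) (A i j))
      (cong (ι (L i ∧ not (L j)) *_)
        (trans (cong (_* A i j) (one (toℕ i) (toℕ j) (i≢j ∘ Fin.toℕ-injective)))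
               (*-identityˡ _)))

arcs-cong : {M : Matrix n} {A A′ B B′ : VertexSet n} →
            (∀ i → A i ≡ A′ i) → (∀ i → B i ≡ B′ i) → arcs M A B ≡ arcs M A′ B′
arcs-cong {M = M} p q = total-cong λ i j → cong (λ b → ι b * M i j) (cong₂ _∧_ (p i) (q j))

∂⁺-cong : {M : Matrix n} {A A′ : VertexSet n} → (∀ i → A i ≡ A′ i) → ∂⁺ M A ≡ ∂⁺ M A′
∂⁺-cong p = arcs-cong p (cong not ∘ p)

cut-tabulate : (G : Graph n) (A : VertexSet n) → cut G (tabulate A) ≡ ∂⁺ (adjacency G) A
cut-tabulate G A = trans (cut≡∂⁺ G (tabulate A)) (∂⁺-cong (lookup∘tabulate A))

-- Query programs and the search for unknown edges

-- A `QTree` returns only subsets. Programs return any type, so that the phases can hand their state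
-- on through `_>>=_`.
data Prog (n : ℕ) (X : Set) : Set where
  return : X → Prog n X
  query  : Subset n → (ℕ → Prog n X) → Prog n X

infixl 1 _>>=_
_>>=_ : Prog n X → (X → Prog n Y) → Prog n Y
return x  >>= k = k x
query Q p >>= k = query Q λ a → p a >>= k

eval : Prog n X → (Subset n → ℕ) → X
eval (return x)  O = x
eval (query Q p) O = eval (p (O Q)) O

eval->>= : (p : Prog n X) (k : X → Prog n Y) (O : Subset n → ℕ) →
           eval (p >>= k) O ≡ eval (k (eval p O)) O
eval->>= (return x)  k O = refl
eval->>= (query Q p) k O = eval->>= (p (O Q)) k O

infix 4 _within_
-- The bound ranges over every conceivable answer, even those of no graph, so costs are proved apart
-- from correctness.
_within_ : Prog n X → ℕ → Set
return x  within c     = ⊤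
query Q p within zero  = ⊥
query Q p within suc c = ∀ a → p a within c

within-mono : ∀ {c d} (p : Prog n X) → c ≤ d → p within c → p within d
within-mono (return x)  c≤d       w = tt
within-mono (query Q p) (s≤s c≤d) w = λ a → within-mono (p a) c≤d (w a)

within->>= : ∀ {c d} (p : Prog n X) {k : X → Prog n Y} → p within c → (∀ x → k x within d) →
             (p >>= k) within c + d
within->>= {c = c} {d} (return x) {k} wp wk = within-mono (k x) (m≤n+m d c) (wk x)
within->>= {c = suc c} (query Q p) wp wk = λ a → within->>= (p a) (wp a) wk

toTree : Prog n (Subset n) → QTree n
toTree (return S)  = ret S
toTree (query Q p) = ask Q (toTree ∘ p)

run-toTree-output : (p : Prog n (Subset n)) (O : Subset n → ℕ) → proj₁ (run (toTree p) O) ≡ eval p O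
run-toTree-output (return S)  O = refl
run-toTree-output (query Q p) O = run-toTree-output (p (O Q)) O

run-toTree-cost : ∀ {c} (p : Prog n (Subset n)) (O : Subset n → ℕ) →
                  p within c → proj₂ (run (toTree p) O) ≤ c
run-toTree-cost (return S)  O w = z≤n
run-toTree-cost {c = suc c} (query Q p) O w = s≤s (run-toTree-cost (p (O Q)) O (w (O Q)))

does-true : {P : Set} (p? : Dec P) → does p? ≡ true → P
does-true (yes p) _ = p

does-false : {P : Set} (p? : Dec P) → does p? ≡ false → ¬ P
does-false (no ¬p) _ = ¬p

<ᵇ-true : ∀ {x y} → (x <ᵇ y) ≡ true → x < y
<ᵇ-true {x} {y} = does-true (x <? y)

<ᵇ-false : ∀ {x y} → (x <ᵇ y) ≡ false → y ≤ x
<ᵇ-false {x} {y} p = ≮⇒≥ (does-false (x <? y) p)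

∧-elimˡ : ∀ {a b} → a ∧ b ≡ true → a ≡ true
∧-elimˡ {true} _ = refl

∧-elimʳ : ∀ {a b} → a ∧ b ≡ true → b ≡ true
∧-elimʳ {true} p = p

∧-intro : ∀ {a b} → a ≡ true → b ≡ true → a ∧ b ≡ true
∧-intro refl refl = refl

record KnownSubgraph (G : Graph n) (K : Matrix n) : Set where
  field
    symmetric : Symmetric K
    bounded   : ∀ i j → K i j ≤ adjacency G i j
open KnownSubgraph

Unknown : Graph n → Matrix n → Fin n → Fin n → Set
Unknown G K i j = K i j < adjacency G i j

Disjoint : VertexSet n → VertexSet n → Set
Disjoint A B = ∀ i → A i ∧ B i ≡ false

_⊆ₛ_ : VertexSet n → VertexSet n → Set
A ⊆ₛ B = ∀ v → A v ≡ true → B v ≡ true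

disjoint-⊆ʳ : {A B X : VertexSet n} → X ⊆ₛ B → Disjoint A B → Disjoint A X
disjoint-⊆ʳ {A = A} {B} {X} X⊆B A∩B=∅ i with X i in eq
... | false = Bool.∧-zeroʳ (A i)
... | true  = subst (λ b → A i ∧ b ≡ false) (X⊆B i eq) (A∩B=∅ i)

disjoint-single : {X : VertexSet n} {y : Fin n} → ¬ X y ≡ true → Disjoint X (single y)
disjoint-single {X = X} {y} y∉X i with single y i in eq
... | false = Bool.∧-zeroʳ (X i)
... | true  = trans (Bool.∧-identityʳ (X i)) (Bool.¬-not (subst (λ v → ¬ X v ≡ true) (≡-sym (single⇒≡ y i eq)) y∉X))

-- This compares `2 * arcs K A B` with `a + b - c` while avoiding truncated subtraction; for
-- disjoint sets the difference is twice the number of edges of the graph between them.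
testUnknown : Matrix n → VertexSet n → VertexSet n → Prog n Bool
testUnknown K A B =
  query (tabulate (A ∪ B)) λ c → query (tabulate A) λ a → query (tabulate B) λ b →
  return (does (c + 2 * arcs K A B <? a + b))

testUnknown-within : (K : Matrix n) (A B : VertexSet n) → testUnknown K A B within 3
testUnknown-within K A B _ _ _ = tt

module _ {G : Graph n} {K : Matrix n} (known : KnownSubgraph G K) {A B : VertexSet n} (A∩B=∅ : Disjoint A B) where

  private
    A′ = adjacency G

    cut-identity : cut G (tabulate A) + cut G (tabulate B) ≡ cut G (tabulate (A ∪ B)) + 2 * arcs A′ A B
    cut-identity = begin
      cut G (tabulate A) + cut G (tabulate B)        ≡⟨ cong₂ _+_ (cut-tabulate G A) (cut-tabulate G B) ⟩
      ∂⁺ A′ A + ∂⁺ A′ B                              ≡⟨ ∂⁺-disjoint-∪ (adjacency-sym G) A B A∩B=∅ ⟩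
      ∂⁺ A′ (A ∪ B) + 2 * arcs A′ A B                ≡⟨ cong (_+ 2 * arcs A′ A B) (cut-tabulate G (A ∪ B)) ⟨
      cut G (tabulate (A ∪ B)) + 2 * arcs A′ A B     ∎
      where open ≡-Reasoning

  testUnknown-true : eval (testUnknown K A B) (cut G) ≡ true →
                     ∃[ i ] ∃[ j ] (A i ≡ true × B j ≡ true × Unknown G K i j)
  testUnknown-true p with total-<⇒∃< {n} (λ i j → ι (A i ∧ B j) * K i j) (λ i j → ι (A i ∧ B j) * A′ i j) fewer
    where
    fewer : arcs K A B < arcs A′ A B
    fewer = *-cancelˡ-< 2 _ _ (+-cancelˡ-< (cut G (tabulate (A ∪ B))) _ _
              (subst (cut G (tabulate (A ∪ B)) + 2 * arcs K A B <_) cut-identity (does-true (_ <? _) p)))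
  ... | i , j , lt with A i in eqA | B j in eqB
  ...   | true | true = i , j , eqA , eqB , subst₂ _<_ (*-identityˡ _) (*-identityˡ _) lt

  -- Since `K` lies below the graph entrywise, one unknown pair makes the totals differ strictly; no
  -- other entry can compensate for it.
  testUnknown-false : eval (testUnknown K A B) (cut G) ≡ false →
                      ∀ {i j} → A i ≡ true → B j ≡ true → ¬ Unknown G K i j
  testUnknown-false p {i} {j} Ai Bj unk = does-false (_ <? _) p
    (subst (cut G (tabulate (A ∪ B)) + 2 * arcs K A B <_) (≡-sym cut-identity)
      (+-monoʳ-< (cut G (tabulate (A ∪ B))) (*-monoʳ-< 2
        (total-mono-< {n} (λ i j → *-monoʳ-≤ (ι (A i ∧ B j)) (bounded known i j)) i j
          (subst (λ b → ι b * K i j < ι b * A′ i j) (≡-sym (∧-intro Ai Bj))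
            (subst₂ _<_ (≡-sym (*-identityˡ _)) (≡-sym (*-identityˡ _)) unk))))))

-- Bisection for a vertex

pick : Fin n → VertexSet n → Fin n
pick default B with Fin.any? (λ v → B v Bool.≟ true)
... | yes (v , _) = v
... | no _        = default

pick-∈ : (default : Fin n) (B : VertexSet n) → ∀ {v} → B v ≡ true → B (pick default B) ≡ true
pick-∈ default B {v} Bv with Fin.any? (λ v → B v Bool.≟ true)
... | yes (_ , Bu) = Bu
... | no ¬any      = contradiction (v , Bv) ¬any

below : ℕ → VertexSet n
below m v = toℕ v <ᵇ m

-- The candidates are meant to have indices from `lo` up to `lo + 2 ^ k`, exclusive. Only the lower
-- half is tested: a negative answer already places the witness in the upper half.
bisect : Fin n → (VertexSet n → Prog n Bool) → (k lo : ℕ) → VertexSet n → Prog n (Fin n)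
bisect default test zero    lo B = return (pick default B)
bisect default test (suc k) lo B = test (B ∩ below (lo + 2 ^ k)) >>= λ b →
  if b then bisect default test k lo (B ∩ below (lo + 2 ^ k))
       else bisect default test k (lo + 2 ^ k) (B ∩ ∁ (below (lo + 2 ^ k)))

bisect-within : ∀ {c} (default : Fin n) (test : VertexSet n → Prog n Bool) → (∀ B → test B within c) →
                ∀ k lo B → bisect default test k lo B within k * c
bisect-within default test w zero    lo B = tt
bisect-within default test w (suc k) lo B = within->>= (test _) (w _) λ
  { true  → bisect-within default test w k _ _
  ; false → bisect-within default test w k _ _ }

Detects : (Subset n → ℕ) → Prog n Bool → VertexSet n → (Fin n → Set) → Set
Detects O p B W = (eval p O ≡ true → ∃[ v ] (B v ≡ true × W v)) ×
                  (eval p O ≡ false → ∀ {v} → B v ≡ true → ¬ W v)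

module _ (O : Subset n → ℕ) (default : Fin n) (test : VertexSet n → Prog n Bool)
         (W : Fin n → Set) (B₀ : VertexSet n) (sound : ∀ B → B ⊆ₛ B₀ → Detects O (test B) B W) where

  -- The window halves while a witness stays in `B`. The test need only be sound on subsets of `B₀`,
  -- because cut queries count edges only between disjoint sets.
  bisect-correct : ∀ k lo B → B ⊆ₛ B₀ → (∀ v → B v ≡ true → lo ≤ toℕ v × toℕ v < lo + 2 ^ k) →
                   ∃[ v ] (B v ≡ true × W v) →
                   B₀ (eval (bisect default test k lo B) O) ≡ true ×
                   W (eval (bisect default test k lo B) O)
  -- The window has length one, so the element picked is the witness.
  bisect-correct zero lo B B⊆B₀ range (v , Bv , Wv) =
    B⊆B₀ _ picked , subst W (Fin.toℕ-injective (trans (≡lo v Bv) (≡-sym (≡lo _ picked)))) Wv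
    where
    picked = pick-∈ default B Bv
    ≡lo : ∀ u → B u ≡ true → toℕ u ≡ lo
    ≡lo u Bu = ≤-antisym (≤-pred (subst (toℕ u <_) (+-comm lo 1) (proj₂ (range u Bu)))) (proj₁ (range u Bu))
  bisect-correct (suc k) lo B B⊆B₀ range (v , Bv , Wv)
    rewrite eval->>= (test (B ∩ below (lo + 2 ^ k))) (λ b →
      if b then bisect default test k lo (B ∩ below (lo + 2 ^ k))
           else bisect default test k (lo + 2 ^ k) (B ∩ ∁ (below (lo + 2 ^ k)))) O
    with eval (test (B ∩ below (lo + 2 ^ k))) O
       | sound (B ∩ below (lo + 2 ^ k)) (λ u p → B⊆B₀ u (∧-elimˡ p))
  ... | true  | found , _ = bisect-correct k lo _ (λ u p → B⊆B₀ u (∧-elimˡ p))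
          (λ u p → proj₁ (range u (∧-elimˡ p)) , <ᵇ-true (∧-elimʳ {B u} p)) (found refl)
  ... | false | _ , none = bisect-correct k (lo + 2 ^ k) _ (λ u p → B⊆B₀ u (∧-elimˡ p))
          (λ u p → <ᵇ-false (Bool.not-injective (∧-elimʳ {B u} p)) ,
                   subst (toℕ u <_) (regroup lo (2 ^ k)) (proj₂ (range u (∧-elimˡ p))))
          (v , outside , Wv)
    where
    regroup : ∀ a b → a + 2 * b ≡ a + b + b
    regroup = solve-∀
    outside : B v ∧ not (below (lo + 2 ^ k) v) ≡ true
    outside with below (lo + 2 ^ k) v in eq
    ... | true  = contradiction Wv (none refl (∧-intro Bv eq))
    ... | false = ∧-intro Bv refl

-- The induction follows the well-founded recursion of `⌈log2⌉`, which sends `n + 2` to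
-- `⌈ n /2⌉ + 1`.
n≤2^⌈log₂n⌉ : ∀ n → n ≤ 2 ^ ⌈log₂ n ⌉
n≤2^⌈log₂n⌉ n = go n (<-wellFounded n)
  where
  go : ∀ n (a : Acc _<_ n) → n ≤ 2 ^ ⌈log2⌉ n a
  go 0             _        = z≤n
  go 1             _        = ≤-refl
  go (suc (suc n)) (acc rs) = begin
    suc (suc n)                              ≡⟨ cong (λ m → suc (suc m)) (⌊n/2⌋+⌈n/2⌉≡n n) ⟨
    suc (suc (⌊ n /2⌋ + ⌈ n /2⌉))            ≤⟨ s≤s (s≤s (+-monoˡ-≤ ⌈ n /2⌉ (⌊n/2⌋≤⌈n/2⌉ n))) ⟩
    suc (suc (⌈ n /2⌉ + ⌈ n /2⌉))            ≡⟨ double ⌈ n /2⌉ ⟩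
    2 * suc ⌈ n /2⌉                          ≤⟨ *-monoʳ-≤ 2 (go (suc ⌈ n /2⌉) (rs _)) ⟩
    2 * 2 ^ ⌈log2⌉ (suc ⌈ n /2⌉) (rs _)      ∎
    where
    open ≤-Reasoning
    double : ∀ m → suc (suc (m + m)) ≡ 2 * suc m
    double = solve-∀

-- Halving `B` against all of `A` gives a `y` with an unknown edge into `A`; halving `A` against `y`
-- alone then gives its partner.
locateUnknown : Fin n → Matrix n → VertexSet n → VertexSet n → Prog n (Maybe (Fin n × Fin n))
locateUnknown {n} default K A B =
  bisect default (testUnknown K A) ⌈log₂ n ⌉ 0 B >>= λ y →
  bisect default (λ X → testUnknown K X (single y)) ⌈log₂ n ⌉ 0 A >>= λ x →
  return (just (x , y))

findUnknown : Fin n → Matrix n → VertexSet n → VertexSet n → Prog n (Maybe (Fin n × Fin n))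
findUnknown default K A B = testUnknown K A B >>= λ b →
  if b then locateUnknown default K A B else return nothing

-- Three queries for the first test and for each halving of the two bisections. The trailing `0` is
-- the cost of `return`, kept to match the shape that `within->>=` yields.
findCost : ℕ → ℕ
findCost n = 3 + (⌈log₂ n ⌉ * 3 + (⌈log₂ n ⌉ * 3 + 0))

findUnknown-within : (default : Fin n) (K : Matrix n) (A B : VertexSet n) →
                     findUnknown default K A B within findCost n
findUnknown-within {n} default K A B =
  within->>= {c = 3} (testUnknown K A B) {k = λ b → if b then locateUnknown default K A B else return nothing}
    (testUnknown-within K A B) λ
    { false → tt
    ; true  → within->>= (bisect default (testUnknown K A) ⌈log₂ n ⌉ 0 B)
                (bisect-within default _ (testUnknown-within K A) ⌈log₂ n ⌉ 0 B) λ y →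
              within->>= (bisect default (λ X → testUnknown K X (single y)) ⌈log₂ n ⌉ 0 A)
                (bisect-within default _ (λ X → testUnknown-within K X (single y)) ⌈log₂ n ⌉ 0 A) λ x → tt }

FoundUnknown : Graph n → Matrix n → VertexSet n → VertexSet n → Maybe (Fin n × Fin n) → Set
FoundUnknown G K A B (just (x , y)) = A x ≡ true × B y ≡ true × Unknown G K x y
FoundUnknown G K A B nothing        = ∀ {i j} → A i ≡ true → B j ≡ true → ¬ Unknown G K i j

findUnknown-correct : {G : Graph n} {K : Matrix n} → KnownSubgraph G K → (default : Fin n) →
                      ∀ A B → Disjoint A B → FoundUnknown G K A B (eval (findUnknown default K A B) (cut G))
findUnknown-correct {n} {G} {K} known default A B A∩B=∅
  with eval (testUnknown K A B) (cut G) in tested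
... | false = testUnknown-false known A∩B=∅ tested
... | true
  rewrite eval->>= (bisect default (testUnknown K A) ⌈log₂ n ⌉ 0 B) (λ y →
            bisect default (λ X → testUnknown K X (single y)) ⌈log₂ n ⌉ 0 A >>= λ x →
            return (just (x , y))) (cut G)
  = found
  where
  O = cut G
  L = ⌈log₂ n ⌉
  inRange : ∀ (v : Fin n) → 0 ≤ toℕ v × toℕ v < 0 + 2 ^ L
  inRange v = z≤n , <-≤-trans (Fin.toℕ<n v) (n≤2^⌈log₂n⌉ n)
  y = eval (bisect default (testUnknown K A) L 0 B) O

  soundB : ∀ X → X ⊆ₛ B → Detects O (testUnknown K A X) X (λ v → ∃[ u ] (A u ≡ true × Unknown G K u v))
  soundB X X⊆B = (λ p → let (u , v , Au , Xv , unk) = testUnknown-true known dis p in v , Xv , u , Au , unk)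
               , (λ p Xv (u , Au , unk) → testUnknown-false known dis p Au Xv unk)
    where dis = disjoint-⊆ʳ X⊆B A∩B=∅

  ySpec : B y ≡ true × ∃[ u ] (A u ≡ true × Unknown G K u y)
  ySpec = bisect-correct O default (testUnknown K A) _ B soundB L 0 B (λ _ p → p) (λ v _ → inRange v)
    (let (u , v , Au , Bv , unk) = testUnknown-true known A∩B=∅ tested in v , Bv , u , Au , unk)

  soundA : ∀ X → X ⊆ₛ A → Detects O (testUnknown K X (single y)) X (λ u → Unknown G K u y)
  soundA X X⊆A = (λ p → let (u , v , Xu , v∈ , unk) = testUnknown-true known dis p
                         in u , Xu , subst (Unknown G K u) (single⇒≡ y v v∈) unk)
               , (λ p Xu unk → testUnknown-false known dis p Xu (single-refl y) unk)
    where
    -- The sets tested in the second bisection are disjoint from `single y` because `y` lies in `B`.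
    y∉A : A y ≡ false
    y∉A = trans (≡-sym (Bool.∧-identityʳ (A y))) (subst (λ b → A y ∧ b ≡ false) (proj₁ ySpec) (A∩B=∅ y))
    dis = disjoint-single (Bool.not-¬ y∉A ∘ X⊆A y)

  found : FoundUnknown G K A B (eval (bisect default (λ X → testUnknown K X (single y)) L 0 A >>= λ x →
                                      return (just (x , y))) O)
  found rewrite eval->>= (bisect default (λ X → testUnknown K X (single y)) L 0 A)
                         (λ x → return (just (x , y))) O =
    let (Ax , unk) = bisect-correct O default (λ X → testUnknown K X (single y)) (λ u → Unknown G K u y) A soundA L 0 A
                       (λ _ p → p) (λ v _ → inRange v) (proj₂ ySpec)
    in Ax , proj₁ ySpec , unk

-- Phase 1: push-relabel

unit-values : (x y i j : Fin n) → unit x y i j ≡ 0 ⊎ (i ≡ x × j ≡ y × unit x y i j ≡ 1)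
unit-values x y i j with i Fin.≟ x | j Fin.≟ y
... | no _     | _        = inj₁ refl
... | yes _    | no _     = inj₁ refl
... | yes refl | yes refl = inj₂ (refl , refl , refl)

unit-self : (x y : Fin n) → unit x y x y ≡ 1
unit-self x y rewrite single-refl x | single-refl y = refl

learn : Fin n → Fin n → Matrix n → Matrix n
learn x y K = K ⊞ (unit x y ⊞ unit y x)

unknown⇒≢ : {G : Graph n} {K : Matrix n} {x y : Fin n} → Unknown G K x y → x ≢ y
unknown⇒≢ {G = G} {x = x} unk refl with adj G x x | irrefl G x
unknown⇒≢ () refl | false | _

-- An unknown pair leaves room for one unit at `(x, y)` and, by symmetry, at `(y, x)`. The two units
-- never meet in one entry, since a simple graph has no loops.
learn-known : {G : Graph n} {K : Matrix n} {x y : Fin n} →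
              KnownSubgraph G K → Unknown G K x y → KnownSubgraph G (learn x y K)
symmetric (learn-known {K = K} {x} {y} known unk) i j =
  trans (cong (_+ (unit x y i j + unit y x i j)) (symmetric known i j))
        (cong (K j i +_) (swap (ι (single x i)) (ι (single y j)) (ι (single y i)) (ι (single x j))))
  where
  swap : ∀ a b c d → a * b + c * d ≡ d * c + b * a
  swap = solve-∀
bounded (learn-known {G = G} {K} {x} {y} known unk) i j with unit-values x y i j | unit-values y x i j
... | inj₁ p | inj₁ q rewrite p | q | +-identityʳ (K i j) = bounded known i j
... | inj₂ (refl , refl , p) | inj₁ q rewrite p | q | +-comm (K i j) 1 = unk
... | inj₁ p | inj₂ (refl , refl , q) rewrite p | q | +-comm (K i j) 1 =
  subst₂ _<_ (symmetric known j i) (adjacency-sym G j i) unk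
... | inj₂ (refl , refl , _) | inj₂ (x≡y , _ , _) = contradiction x≡y (unknown⇒≢ {G = G} {K} unk)

bump : Fin n → (Fin n → ℕ) → Fin n → ℕ
bump x f v = f v + ι (single x v)

sum-ι-single : (x : Fin n) → sum (λ v → ι (single x v)) ≡ 1
sum-ι-single x = trans (sum-cong-≗ λ v → ≡-sym (*-identityʳ (ι (single x v)))) (sum-single x (λ _ → 1))

sum-bump : (x : Fin n) (f : Fin n → ℕ) → sum (bump x f) ≡ sum f + 1
sum-bump x f = trans (∑-distrib-+ f (λ v → ι (single x v))) (cong (sum f +_) (sum-ι-single x))

bump-self : (x : Fin n) (f : Fin n → ℕ) → bump x f x ≡ suc (f x)
bump-self x f rewrite single-refl x = +-comm (f x) 1

bump-other : {x v : Fin n} → v ≢ x → (f : Fin n → ℕ) → bump x f v ≡ f v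
bump-other {x = x} {v} v≢x f rewrite single-≢ v≢x = +-identityʳ (f v)

weightOutside : VertexSet n → (Fin n → ℕ) → ℕ
weightOutside S p = sum λ v → ι (not (S v)) * p v

weightOutside-bump : (S : VertexSet n) (x : Fin n) (p : Fin n → ℕ) →
                     weightOutside S (bump x p) ≡ weightOutside S p + ι (not (S x))
weightOutside-bump S x p = begin
  weightOutside S (bump x p)
    ≡⟨ sum-cong-≗ (λ v → trans (*-distribˡ-+ (ι (not (S v))) (p v) (ι (single x v)))
                              (cong (ι (not (S v)) * p v +_) (*-comm (ι (not (S v))) (ι (single x v))))) ⟩
  sum (λ v → ι (not (S v)) * p v + ι (single x v) * ι (not (S v)))
    ≡⟨ ∑-distrib-+ (λ v → ι (not (S v)) * p v) (λ v → ι (single x v) * ι (not (S v))) ⟩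
  weightOutside S p + sum (λ v → ι (single x v) * ι (not (S v)))
    ≡⟨ cong (weightOutside S p +_) (sum-single x (λ v → ι (not (S v)))) ⟩
  weightOutside S p + ι (not (S x)) ∎
  where open ≡-Reasoning

-- pushed i j counts all pushes from i to j, so known i j + pushed j i - pushed i j is the residual capacity.
record State (n : ℕ) : Set where
  constructor state
  field
    known pushed  : Matrix n
    height parked : Fin n → ℕ
    walker        : Fin n
open State

start : Fin n → State n
start = state (λ _ _ → 0) (λ _ _ → 0) (λ _ → 0) (λ _ → 0)

Residual : Matrix n → Matrix n → Fin n → Fin n → Set
Residual M f i j = f i j < M i j + f j i

Admissible : State n → Fin n → Set
Admissible st v = Residual (known st) (pushed st) (walker st) v × height st (walker st) ≡ suc (height st v)

admissible? : (st : State n) → ∀ v → Dec (Admissible st v)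
admissible? st v = (_ <? _) ×-dec (_ ≟ _)

nextLevel : State n → VertexSet n
nextLevel st v = does (height st (walker st) ≟ suc (height st v))

park : Fin n → State n → State n
park s (state K f h p w) = state K f h (bump w p) s

push : Fin n → State n → State n
push v (state K f h p w) = state K (f ⊞ unit w v) h p v

learnFrom : Fin n → State n → State n
learnFrom v (state K f h p w) = state (learn w v K) f h p w

relabel : State n → State n
relabel (state K f h p w) = state K f (bump w h) p w

explore : State n → Maybe (Fin n × Fin n) → State n
-- The search starts from the singleton of the walker, so the dropped component is the walker
-- itself.
explore st (just (_ , v)) = push v (learnFrom v st)
explore st nothing        = relabel st

Finished : Fin n → ℕ → State n → Set
Finished t D st = walker st ≡ t ⊎ D ≤ height st (walker st)

finished? : (t : Fin n) (D : ℕ) (st : State n) → Dec (Finished t D st)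
finished? t D st = (walker st Fin.≟ t) ⊎-dec (D ≤? height st (walker st))

-- Queries are spent only when no known residual arc is admissible. A failed search then justifies
-- the relabelling with respect to the whole graph and not just its known part.
step : Fin n → Fin n → ℕ → State n → Prog n (State n)
step s t D st with finished? t D st
... | yes _ = return (park s st)
... | no _ with Fin.any? (admissible? st)
...   | yes (v , _) = return (push v st)
...   | no _        = findUnknown (walker st) (known st) (single (walker st)) (nextLevel st) >>= λ r →
                      return (explore st r)

step-within : (s t : Fin n) (D : ℕ) (st : State n) → step s t D st within (findCost n + 0)
step-within s t D st with finished? t D st
... | yes _ = _
... | no _ with Fin.any? (admissible? st)
...   | yes _ = _
...   | no _  = within->>= (findUnknown (walker st) (known st) (single (walker st)) (nextLevel st))
                  (findUnknown-within (walker st) (known st) (single (walker st)) (nextLevel st)) (λ r → _)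

pushPhase : Fin n → Fin n → ℕ → ℕ → State n → Prog n (State n)
pushPhase s t D zero    st = return st
pushPhase s t D (suc F) st with D ≤? height st s
... | yes _ = return st
... | no _  = step s t D st >>= pushPhase s t D F

pushPhase-within : (s t : Fin n) (D F : ℕ) (st : State n) → pushPhase s t D F st within (F * (findCost n + 0))
pushPhase-within s t D zero    st = _
pushPhase-within s t D (suc F) st with D ≤? height st s
... | yes _ = _
... | no _  = within->>= (step s t D st) (step-within s t D st) (pushPhase-within s t D F)

module PushPhase (G : Graph n) (s t : Fin n) (s≢t : s ≢ t) (D : ℕ) where

  -- `conservation` reads the tokens as flow out of `s`: the net flow leaving `S` is the number of
  -- tokens outside it. `valid` speaks of residual arcs of all of `G`, so that the levels finally
  -- bound a cut of `G`.
  record Invariant (st : State n) : Set where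
    field
      isKnown      : KnownSubgraph G (known st)
      capacity     : ∀ i j → pushed st i j ≤ known st i j + pushed st j i
      conservation : ∀ S → S s ≡ true → ∂⁺ (pushed st) S ≡
                     arcs (pushed st) (∁ S) S + (weightOutside S (parked st) + ι (not (S (walker st))))
      valid        : ∀ {i j} → Residual (adjacency G) (pushed st) i j → height st i ≤ suc (height st j)
      height≤D     : ∀ v → height st v ≤ D
      sink-height  : height st t ≡ 0
      parked-at    : ∀ v → parked st v ≡ 0 ⊎ v ≡ t ⊎ D ≤ height st v
      source-empty : parked st s ≡ 0
  open Invariant

  -- The weights make potential minus walker height rise at every step: a push lowers the walker by
  -- one, a relabelling gains two and loses one, and parking gains `suc D`, which exceeds the height
  -- of `s` where the next token starts.
  potential : State n → ℕ
  potential st = 2 * sum (height st) + suc D * sum (parked st)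

  -- progress says that potential - height of the walker increases, with no subtraction.
  infix 4 _⟶_
  record _⟶_ (st st′ : State n) : Set where
    field
      invariant : Invariant st′
      progress  : potential st + suc (height st′ (walker st′)) ≤ potential st′ + height st (walker st)
  open _⟶_

  park-step : ∀ {st} → Invariant st → Finished t D st → height st s < D → st ⟶ park s st
  park-step {state K f h p w} I fin hs<D = record
    { invariant = record
      { isKnown = isKnown I ; capacity = capacity I ; conservation = conservation′
      ; valid = valid I ; height≤D = height≤D I ; sink-height = sink-height I
      ; parked-at = parked-at′ ; source-empty = trans (bump-other s≢w p) (source-empty I) }
    ; progress = progress′ }
    where
    -- A token at `s` is not finished, as `s ≢ t` and `s` is below level `D`; hence parking keeps
    -- `s` empty.
    s≢w : s ≢ w
    s≢w refl = [ s≢t , <⇒≱ hs<D ]′ fin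
    conservation′ : ∀ S → S s ≡ true →
      ∂⁺ f S ≡ arcs f (∁ S) S + (weightOutside S (bump w p) + ι (not (S s)))
    conservation′ S Ss rewrite Ss | weightOutside-bump S w p =
      trans (conservation I S Ss) (cong (arcs f (∁ S) S +_) (≡-sym (+-identityʳ _)))
    parked-at′ : ∀ v → bump w p v ≡ 0 ⊎ v ≡ t ⊎ D ≤ h v
    parked-at′ v with v Fin.≟ w
    ... | yes refl = inj₂ fin
    ... | no v≢w   rewrite +-identityʳ (p v) = parked-at I v
    regroup : ∀ a d q → a + d * q + d ≡ a + d * (q + 1)
    regroup = solve-∀
    progress′ : potential (state K f h p w) + suc (h s) ≤ potential (state K f h (bump w p) s) + h w
    progress′ = begin
      2 * sum h + suc D * sum p + suc (h s)  ≤⟨ +-monoʳ-≤ _ (s≤s (<⇒≤ hs<D)) ⟩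
      2 * sum h + suc D * sum p + suc D      ≡⟨ regroup (2 * sum h) (suc D) (sum p) ⟩
      2 * sum h + suc D * (sum p + 1)        ≡⟨ cong (λ q → 2 * sum h + suc D * q) (sum-bump w p) ⟨
      2 * sum h + suc D * sum (bump w p)     ≤⟨ m≤m+n _ _ ⟩
      2 * sum h + suc D * sum (bump w p) + h w ∎
      where open ≤-Reasoning

  push-step : ∀ {st v} → Invariant st → Admissible st v → st ⟶ push v st
  push-step {state K f h p w} {v} I (res , hw≡1+hv) = record
    { invariant = record
      { isKnown = isKnown I ; capacity = capacity′ ; conservation = conservation′
      ; valid = valid′ ; height≤D = height≤D I ; sink-height = sink-height I
      ; parked-at = parked-at I ; source-empty = source-empty I }
    ; progress = +-monoʳ-≤ _ (≤-reflexive (≡-sym hw≡1+hv)) }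
    where
    capacity′ : ∀ i j → f i j + unit w v i j ≤ K i j + (f j i + unit w v j i)
    capacity′ i j with unit-values w v i j
    ... | inj₁ q rewrite q | +-identityʳ (f i j) | ≡-sym (+-assoc (K i j) (f j i) (unit w v j i)) =
      ≤-trans (capacity I i j) (m≤m+n _ _)
    ... | inj₂ (refl , refl , q) rewrite q | +-comm (f i j) 1 | ≡-sym (+-assoc (K i j) (f j i) (unit w v j i)) =
      ≤-trans res (m≤m+n _ _)
    -- A push from `w` to `v` can only create the residual arc from `v` back to `w`, and that arc
    -- goes up.
    valid′ : ∀ {i j} → f i j + unit w v i j < adjacency G i j + (f j i + unit w v j i) → h i ≤ suc (h j)
    valid′ {i} {j} r with unit-values w v j i
    ... | inj₁ q rewrite q | +-identityʳ (f j i) = valid I (≤-<-trans (m≤m+n _ _) r)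
    ... | inj₂ (refl , refl , _) = ≤-trans (n≤1+n _) (≤-trans (≤-reflexive (≡-sym hw≡1+hv)) (n≤1+n _))
    -- `a` and `b` tell whether the walker is in `S` before and after the push.
    balance : ∀ a b P Q T → P ≡ Q + (T + ι (not a)) →
              P + ι (a ∧ not b) ≡ Q + ι (not a ∧ b) + (T + ι (not b))
    balance false false P Q T e rewrite e = rearrange Q T
      where rearrange : ∀ Q T → Q + (T + 1) + 0 ≡ Q + 0 + (T + 1)
            rearrange = solve-∀
    balance false true P Q T e rewrite e = rearrange Q T
      where rearrange : ∀ Q T → Q + (T + 1) + 0 ≡ Q + 1 + (T + 0)
            rearrange = solve-∀
    balance true false P Q T e rewrite e = rearrange Q T
      where rearrange : ∀ Q T → Q + (T + 0) + 1 ≡ Q + 0 + (T + 1)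
            rearrange = solve-∀
    balance true true P Q T e rewrite e = rearrange Q T
      where rearrange : ∀ Q T → Q + (T + 0) + 0 ≡ Q + 0 + (T + 0)
            rearrange = solve-∀
    conservation′ : ∀ S → S s ≡ true → ∂⁺ (f ⊞ unit w v) S ≡
      arcs (f ⊞ unit w v) (∁ S) S + (weightOutside S p + ι (not (S v)))
    conservation′ S Ss
      rewrite arcs-⊞ f (unit w v) S (∁ S) | arcs-unit w v S (∁ S)
            | arcs-⊞ f (unit w v) (∁ S) S | arcs-unit w v (∁ S) S
      = balance (S w) (S v) (∂⁺ f S) (arcs f (∁ S) S) (weightOutside S p) (conservation I S Ss)

  learn-invariant : ∀ {st v} → Invariant st → Unknown G (known st) (walker st) v → Invariant (learnFrom v st)
  learn-invariant {state K f h p w} I unk = record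
    { isKnown = learn-known (isKnown I) unk
    ; capacity = λ i j → ≤-trans (capacity I i j) (+-monoˡ-≤ (f j i) (m≤m+n (K i j) _))
    ; conservation = conservation I ; valid = valid I ; height≤D = height≤D I ; sink-height = sink-height I
    ; parked-at = parked-at I ; source-empty = source-empty I }

  learn-step : ∀ {st v} → Invariant st → Unknown G (known st) (walker st) v →
               height st (walker st) ≡ suc (height st v) → st ⟶ push v (learnFrom v st)
  learn-step {st@(state K f h p w)} {v} I unk level =
    record { invariant = invariant pushed-step ; progress = progress pushed-step }
    where
    -- The flow respected the capacity before the edge was learned, so the new unit is free.
    residual : f w v < K w v + (unit w v w v + unit v w w v) + f v w
    residual rewrite unit-self w v = ≤-trans (s≤s (capacity I w v))
      (+-monoˡ-≤ (f v w) (≤-trans (≤-reflexive (≡-sym (+-comm (K w v) 1))) (+-monoʳ-≤ (K w v) (m≤m+n 1 _))))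
    pushed-step : learnFrom v st ⟶ push v (learnFrom v st)
    pushed-step = push-step (learn-invariant I unk) (residual , level)

  relabel-step : ∀ {st} → Invariant st → ¬ Finished t D st → (∀ v → ¬ Admissible st v) →
                 (∀ v → height st (walker st) ≡ suc (height st v) → ¬ Unknown G (known st) (walker st) v) →
                 st ⟶ relabel st
  relabel-step {state K f h p w} I ¬fin ¬adm ¬unk = record
    { invariant = record
      { isKnown = isKnown I ; capacity = capacity I ; conservation = conservation I
      ; valid = valid′ ; height≤D = height≤D′
      ; sink-height = trans (bump-other (λ t≡w → ¬fin (inj₁ (≡-sym t≡w))) h) (sink-height I)
      ; parked-at = parked-at′ ; source-empty = source-empty I }
    ; progress = progress′ }
    where
    height≤D′ : ∀ v → bump w h v ≤ D
    height≤D′ v with v Fin.≟ w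
    ... | yes refl rewrite +-comm (h v) 1 = ≰⇒> (¬fin ∘ inj₂)
    ... | no _     rewrite +-identityʳ (h v) = height≤D I v
    parked-at′ : ∀ v → p v ≡ 0 ⊎ v ≡ t ⊎ D ≤ bump w h v
    parked-at′ v with parked-at I v
    ... | inj₁ q        = inj₁ q
    ... | inj₂ (inj₁ q) = inj₂ (inj₁ q)
    ... | inj₂ (inj₂ q) = inj₂ (inj₂ (≤-trans q (m≤m+n _ _)))
    -- A residual arc of `G` is residual in `K` or its edge is unknown; one level down, both are
    -- excluded. So no residual arc leads down from the walker, which may rise by one.
    not-level : ∀ {j} → Residual (adjacency G) f w j → h w ≢ suc (h j)
    not-level {j} r level with f w j <? K w j + f j w
    ... | yes q = ¬adm j (q , level)
    ... | no ¬q = ¬unk j level (+-cancelʳ-< (f j w) _ _ (≤-<-trans (≮⇒≥ ¬q) r))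
    valid′ : ∀ {i j} → Residual (adjacency G) f i j → bump w h i ≤ suc (bump w h j)
    valid′ {i} {j} r with i Fin.≟ w
    ... | no _ rewrite +-identityʳ (h i) = ≤-trans (valid I r) (s≤s (m≤m+n _ _))
    ... | yes refl rewrite +-comm (h i) 1 =
      s≤s (≤-trans (≤-pred (≤∧≢⇒< (valid I r) (not-level r))) (m≤m+n _ _))
    regroup : ∀ a x b → 2 * a + x + suc (suc b) ≡ 2 * (a + 1) + x + b
    regroup = solve-∀
    progress′ : potential (state K f h p w) + suc (bump w h w) ≤ potential (state K f (bump w h) p w) + h w
    progress′ rewrite bump-self w h | sum-bump w h = ≤-reflexive (regroup (sum h) (suc D * sum p) (h w))

  step-correct : ∀ {st} → Invariant st → height st s < D → st ⟶ eval (step s t D st) (cut G)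
  step-correct {st} I hs<D with finished? t D st
  ... | yes fin = park-step I fin hs<D
  ... | no ¬fin with Fin.any? (admissible? st)
  ...   | yes (v , adm) = push-step I adm
  ...   | no ¬adm
    rewrite eval->>= (findUnknown (walker st) (known st) (single (walker st)) (nextLevel st))
                     (λ r → return (explore st r)) (cut G)
    with eval (findUnknown (walker st) (known st) (single (walker st)) (nextLevel st)) (cut G)
       | findUnknown-correct (isKnown I) (walker st) (single (walker st)) (nextLevel st) disjoint
    where
    disjoint : Disjoint (single (walker st)) (nextLevel st)
    disjoint i with i Fin.≟ walker st
    ... | no _     = refl
    ... | yes refl = dec-false (height st i ≟ suc (height st i)) (λ p → 1+n≢n (≡-sym p))
  ...     | just (x , y) | x∈ , y∈ , unk =
    learn-step I (subst (λ w → Unknown G (known st) w y) (single⇒≡ (walker st) x x∈) unk)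
               (does-true (_ ≟ _) y∈)
  ...     | nothing | none = relabel-step I ¬fin (λ v adm → ¬adm (v , adm))
    (λ v level → none (single-refl (walker st)) (dec-true (_ ≟ _) level))

  -- Weak duality: by `capacity`, the net flow across a cut is at most its known capacity. The
  -- walking token is dropped from the count.
  outside≤∂⁺ : ∀ {st} → Invariant st → ∀ S → S s ≡ true → weightOutside S (parked st) ≤ ∂⁺ (known st) S
  outside≤∂⁺ {state K f h p w} I S Ss = ≤-trans (m≤m+n _ _)
    (+-cancelˡ-≤ (arcs f (∁ S) S) _ _ (begin
      arcs f (∁ S) S + (weightOutside S p + ι (not (S w)))  ≡⟨ conservation I S Ss ⟨
      ∂⁺ f S                                                ≤⟨ arcs-mono (capacity I) S (∁ S) ⟩
      arcs (K ⊞ (λ i j → f j i)) S (∁ S)                    ≡⟨ arcs-⊞ K (λ i j → f j i) S (∁ S) ⟩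
      ∂⁺ K S + arcs (λ i j → f j i) S (∁ S)                 ≡⟨ cong (∂⁺ K S +_) (transpose-arcs f S (∁ S)) ⟩
      ∂⁺ K S + arcs f (∁ S) S                               ≡⟨ +-comm (∂⁺ K S) _ ⟩
      arcs f (∁ S) S + ∂⁺ K S                               ∎))
    where open ≤-Reasoning

  -- Supplies the lower bound `base` of `RefinePhase`.
  parked-sink≤∂⁺ : ∀ {st} → Invariant st → ∀ S → S s ≡ true → S t ≡ false → parked st t ≤ ∂⁺ (known st) S
  parked-sink≤∂⁺ {st} I S Ss St = ≤-trans (≤-reflexive t-term)
    (≤-trans (term≤sum (λ v → ι (not (S v)) * parked st v) t) (outside≤∂⁺ I S Ss))
    where
    t-term : parked st t ≡ ι (not (S t)) * parked st t
    t-term rewrite St = ≡-sym (+-identityʳ _)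

  -- Weak duality for the cut around `s`: nothing is parked at `s`, and a simple graph has at most
  -- `n` edges there.
  sum-parked≤n : ∀ {st} → Invariant st → sum (parked st) ≤ n
  sum-parked≤n {st} I = begin
    sum (parked st)                        ≡⟨ sum-cong-≗ outside ⟩
    weightOutside (single s) (parked st)   ≤⟨ outside≤∂⁺ I (single s) (single-refl s) ⟩
    ∂⁺ (known st) (single s)               ≤⟨ total-mono (λ i j → *-mono-≤ (drop (single s i) _)
                                                (≤-trans (bounded (isKnown I) i j) (adjacency≤1 G i j))) ⟩
    total (λ i (j : Fin n) → ι (single s i) * 1) ≡⟨ total-* (λ i → ι (single s i)) (λ (_ : Fin n) → 1) ⟩
    sum (λ i → ι (single s i)) * sum (λ (_ : Fin n) → 1)
                                           ≡⟨ cong₂ _*_ (sum-ι-single s) (trans (sum-const n 1) (*-identityʳ n)) ⟩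
    1 * n                                  ≡⟨ *-identityˡ n ⟩
    n                                      ∎
    where
    open ≤-Reasoning
    drop : ∀ a b → ι (a ∧ b) ≤ ι a
    drop false b     = z≤n
    drop true  false = z≤n
    drop true  true  = ≤-refl
    outside : ∀ v → parked st v ≡ ι (not (single s v)) * parked st v
    outside v with v Fin.≟ s
    ... | yes refl = source-empty I
    ... | no _     = ≡-sym (+-identityʳ _)

  maxPotential : ℕ
  maxPotential = 2 * (n * D) + suc D * n

  potential≤max : ∀ {st} → Invariant st → potential st ≤ maxPotential
  potential≤max I = +-mono-≤ (*-monoʳ-≤ 2 (sum-bounded (height≤D I))) (*-monoʳ-≤ (suc D) (sum-parked≤n I))

  -- Potential minus walker height rises at every step and stays at most `maxPotential`, so the fuel
  -- outlasts the steps. Adding the same term to both sides replaces the subtraction.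
  pushPhase-correct : ∀ F {st} → Invariant st → maxPotential + height st (walker st) < F + potential st →
    Invariant (eval (pushPhase s t D F st) (cut G)) × D ≤ height (eval (pushPhase s t D F st) (cut G)) s
  pushPhase-correct zero I fuel =
    contradiction (<-≤-trans (≤-<-trans (m≤m+n _ _) fuel) (potential≤max I)) (<-irrefl refl)
  pushPhase-correct (suc F) {st} I fuel with D ≤? height st s
  ... | yes D≤hs = I , D≤hs
  ... | no ¬D≤hs rewrite eval->>= (step s t D st) (pushPhase s t D F) (cut G) =
    pushPhase-correct F (invariant next) (+-cancelʳ-< (suc (potential st + height st (walker st))) _ _ (begin-strict
      maxPotential + height st′ (walker st′) + suc (potential st + height st (walker st))
        ≡⟨ regroup₁ maxPotential (height st′ (walker st′)) (potential st) (height st (walker st)) ⟩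
      (maxPotential + height st (walker st)) + (potential st + suc (height st′ (walker st′)))
        <⟨ +-mono-<-≤ fuel (progress next) ⟩
      (suc F + potential st) + (potential st′ + height st (walker st))
        ≡⟨ regroup₂ F (potential st) (potential st′) (height st (walker st)) ⟩
      F + potential st′ + suc (potential st + height st (walker st)) ∎))
    where
    open ≤-Reasoning
    st′ = eval (step s t D st) (cut G)
    next = step-correct I (≰⇒> ¬D≤hs)
    regroup₁ : ∀ m h′ p h → m + h′ + suc (p + h) ≡ (m + h) + (p + suc h′)
    regroup₁ = solve-∀
    regroup₂ : ∀ F p p′ h → (suc F + p) + (p′ + h) ≡ F + p′ + suc (p + h)
    regroup₂ = solve-∀

  start-invariant : Invariant (start s)
  start-invariant = record
    { isKnown = record { symmetric = λ _ _ → refl ; bounded = λ _ _ → z≤n }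
    ; capacity = λ _ _ → z≤n
    ; conservation = λ S Ss → trans (arcs-zero S (∁ S))
        (≡-sym (cong₂ _+_ (arcs-zero (∁ S) S) (cong₂ _+_ (weight-zero S) (cong (ι ∘ not) Ss))))
    ; valid = λ _ → z≤n ; height≤D = λ _ → z≤n ; sink-height = refl
    ; parked-at = λ _ → inj₁ refl ; source-empty = refl }
    where
    weight-zero : ∀ S → weightOutside {n} S (λ _ → 0) ≡ 0
    weight-zero S = sum-zero λ v → *-zeroʳ (ι (not (S v)))

  -- Narrow levels and a nearly minimum cut

  level : State n → ℕ → VertexSet n
  level st m v = does (height st v ≟ m)

  upper : State n → ℕ → VertexSet n
  upper st k v = k <ᵇ height st v

  upper-true : ∀ {st k v} → k < height st v → upper st k v ≡ true
  upper-true {st} {k} {v} = dec-true (k <? height st v)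

  -- A residual arc leaving the upper set drops exactly one level and has capacity at most 2.
  level-cut : ∀ {st} → Invariant st → D ≤ height st s → ∀ {k} → k < D →
    ∂⁺ (adjacency G) (upper st k) ≤ parked st t + 1 + 2 * (∣ level st (suc k) ∣ₛ * ∣ level st k ∣ₛ)
  level-cut {st@(state K f h p w)} I D≤hs {k} k<D =
    +-cancelˡ-≤ (arcs f (∁ S) S) _ _ (begin
      arcs f (∁ S) S + ∂⁺ A S
        ≡⟨ +-comm (arcs f (∁ S) S) (∂⁺ A S) ⟩
      ∂⁺ A S + arcs f (∁ S) S
        ≡⟨ cong (∂⁺ A S +_) (transpose-arcs f S (∁ S)) ⟨
      ∂⁺ A S + arcs (λ i j → f j i) S (∁ S)
        ≡⟨ total-+ {n} (λ i j → ι (S i ∧ not (S j)) * A i j) (λ i j → ι (S i ∧ not (S j)) * f j i) ⟨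
      total (λ i j → ι (S i ∧ not (S j)) * A i j + ι (S i ∧ not (S j)) * f j i)
        ≤⟨ total-mono pointwise ⟩
      total (λ i j → ι (S i ∧ not (S j)) * f i j + 2 * ι (level st (suc k) i) * ι (level st k j))
        ≡⟨ total-+ {n} (λ i j → ι (S i ∧ not (S j)) * f i j) (λ i j → 2 * ι (level st (suc k) i) * ι (level st k j)) ⟩
      ∂⁺ f S + total (λ i j → 2 * ι (level st (suc k) i) * ι (level st k j))
        ≡⟨ cong₂ _+_ (conservation I S Ss) (trans (total-* (λ i → 2 * ι (level st (suc k) i)) (ι ∘ level st k))
             (trans (cong (_* ∣ level st k ∣ₛ) (≡-sym (*-distribˡ-sum 2 (ι ∘ level st (suc k)))))
                    (*-assoc 2 ∣ level st (suc k) ∣ₛ ∣ level st k ∣ₛ))) ⟩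
      arcs f (∁ S) S + (weightOutside S p + ι (not (S w))) + 2 * (∣ level st (suc k) ∣ₛ * ∣ level st k ∣ₛ)
        ≤⟨ +-monoˡ-≤ _ (+-monoʳ-≤ (arcs f (∁ S) S) (+-mono-≤ outside (ι≤1 (not (S w))))) ⟩
      arcs f (∁ S) S + (p t + 1) + 2 * (∣ level st (suc k) ∣ₛ * ∣ level st k ∣ₛ)
        ≡⟨ +-assoc (arcs f (∁ S) S) (p t + 1) _ ⟩
      arcs f (∁ S) S + (p t + 1 + 2 * (∣ level st (suc k) ∣ₛ * ∣ level st k ∣ₛ)) ∎)
    where
    open ≤-Reasoning
    S = upper st k
    A = adjacency G
    Ss : S s ≡ true
    Ss = upper-true {st} (<-≤-trans k<D D≤hs)
    ι≤1 : ∀ b → ι b ≤ 1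
    ι≤1 false = z≤n
    ι≤1 true  = ≤-refl
    -- Tokens parked away from `t` sit at height at least `D`, hence inside `S`.
    outside : weightOutside S p ≤ p t
    outside = ≤-trans (sum-mono term) (≤-reflexive (sum-single t p))
      where
      term : ∀ v → ι (not (S v)) * p v ≤ ι (single t v) * p v
      term v with S v in eq
      ... | true = z≤n
      ... | false with parked-at I v
      ...   | inj₁ q rewrite q = ≤-trans (≤-reflexive (*-zeroʳ 1)) z≤n
      ...   | inj₂ (inj₁ refl) rewrite single-refl v = ≤-refl
      ...   | inj₂ (inj₂ D≤hv) = contradiction (<-≤-trans k<D D≤hv) (≤⇒≯ (<ᵇ-false eq))
    -- One unit comes from the edge itself and one from undoing net flow in the opposite direction.
    residual≤2 : ∀ i j → A i j + f j i ≤ f i j + 2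
    residual≤2 i j = begin
      A i j + f j i              ≤⟨ +-mono-≤ (adjacency≤1 G i j) (capacity I j i) ⟩
      1 + (K j i + f i j)        ≤⟨ s≤s (+-monoˡ-≤ (f i j) (≤-trans (bounded (isKnown I) j i) (adjacency≤1 G j i))) ⟩
      2 + f i j                  ≡⟨ +-comm 2 (f i j) ⟩
      f i j + 2                  ∎
    pointwise : ∀ i j → ι (S i ∧ not (S j)) * A i j + ι (S i ∧ not (S j)) * f j i ≤
                        ι (S i ∧ not (S j)) * f i j + 2 * ι (level st (suc k) i) * ι (level st k j)
    pointwise i j with S i in Si | S j in Sj
    ... | false | _    = z≤n
    ... | true  | true = z≤n
    ... | true  | false rewrite +-identityʳ (A i j) | +-identityʳ (f j i) | +-identityʳ (f i j)
      with f i j <? A i j + f j i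
    ...   | no ¬res = ≤-trans (≮⇒≥ ¬res) (m≤m+n _ _)
    ...   | yes res
      rewrite dec-true (h i ≟ suc k) (≤-antisym (≤-trans (valid I res) (s≤s (<ᵇ-false Sj))) (<ᵇ-true Si))
            | dec-true (h j ≟ k) (≤-antisym (<ᵇ-false Sj) (≤-pred (≤-trans (<ᵇ-true Si) (valid I res))))
      = residual≤2 i j

  levels-disjoint : ∀ st m → sum {m} (λ k → ∣ level st (toℕ k) ∣ₛ) ≤ n
  levels-disjoint st m = begin
    sum {m} (λ k → sum (λ v → ι (level st (toℕ k) v)))  ≡⟨ ∑-comm {m} {n} (λ k v → ι (level st (toℕ k) v)) ⟩
    sum (λ v → sum {m} (λ k → ι (level st (toℕ k) v)))  ≤⟨ sum-bounded (λ v → at-most-one m (height st v)) ⟩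
    n * 1                                               ≡⟨ *-identityʳ n ⟩
    n                                                   ∎
    where
    open ≤-Reasoning
    at-most-one : ∀ m x → sum {m} (λ k → ι (does (x ≟ toℕ k))) ≤ 1
    at-most-one zero    x       = z≤n
    at-most-one (suc m) zero    = s≤s (≤-reflexive (trans (sum-const m 0) (*-zeroʳ m)))
    at-most-one (suc m) (suc x) = at-most-one m x

  -- AM-GM without subtraction: raising both arguments by one adds `4 * (x + y + 1)` to both sides.
  4xy≤[x+y]² : ∀ x y → 4 * (x * y) ≤ (x + y) * (x + y)
  4xy≤[x+y]² zero    y       = z≤n
  4xy≤[x+y]² (suc x) zero    rewrite *-zeroʳ x = z≤n
  4xy≤[x+y]² (suc x) (suc y) = begin
    4 * (suc x * suc y)                       ≡⟨ left x y ⟩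
    4 * (x * y) + 4 * (x + y + 1)             ≤⟨ +-monoˡ-≤ _ (4xy≤[x+y]² x y) ⟩
    (x + y) * (x + y) + 4 * (x + y + 1)       ≡⟨ right x y ⟩
    (suc x + suc y) * (suc x + suc y)         ∎
    where
    open ≤-Reasoning
    left : ∀ x y → 4 * (suc x * suc y) ≡ 4 * (x * y) + 4 * (x + y + 1)
    left = solve-∀
    right : ∀ x y → (x + y) * (x + y) + 4 * (x + y + 1) ≡ (suc x + suc y) * (suc x + suc y)
    right = solve-∀

  -- Over the `D` pairs of consecutive levels each vertex is counted at most twice, so some pair
  -- holds at most `2 * a` vertices. By AM-GM the product of its two sizes is at most `a * a`.
  small-cut : ∀ {st} → Invariant st → D ≤ height st s → ∀ a → 1 ≤ D → D ≡ a * a → n ≤ a * a * a →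
              ∃[ S ] (S s ≡ true × S t ≡ false × ∂⁺ (adjacency G) S ≤ parked st t + 1 + 2 * (a * a))
  small-cut {st} I D≤hs a 1≤D D≡a² n≤a³ = upper st (toℕ k) , upper-true {st} (<-≤-trans k<D D≤hs) , Sₜ ,
    ≤-trans (level-cut I D≤hs k<D)
            (+-monoʳ-≤ (parked st t + 1) (*-monoʳ-≤ 2 (*-cancelˡ-≤ {ℓ (suc (toℕ k)) * ℓ (toℕ k)} {a * a} 4 (≤-trans (4xy≤[x+y]² (ℓ (suc (toℕ k))) (ℓ (toℕ k)))
              (≤-trans (*-mono-≤ narrow narrow) (≤-reflexive (square a)))))))
    where
    square : ∀ a → (2 * a) * (2 * a) ≡ 4 * (a * a)
    square = solve-∀
    regroup : ∀ a → a * a * a + a * a * a ≡ a * a * (2 * a)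
    regroup = solve-∀
    ℓ = λ (m : ℕ) → ∣ level st m ∣ₛ
    average : sum {D} (λ k → ℓ (suc (toℕ k)) + ℓ (toℕ k)) ≤ D * (2 * a)
    average = begin
      sum {D} (λ k → ℓ (suc (toℕ k)) + ℓ (toℕ k))
        ≡⟨ ∑-distrib-+ {D} (λ k → ℓ (suc (toℕ k))) (λ k → ℓ (toℕ k)) ⟩
      sum {D} (λ k → ℓ (suc (toℕ k))) + sum {D} (λ k → ℓ (toℕ k))
        -- The shifted sum is the sum over the levels `0` to `D` without its first term.
        ≤⟨ +-mono-≤ (≤-trans (m≤n+m _ (ℓ 0)) (levels-disjoint st (suc D))) (levels-disjoint st D) ⟩
      n + n                   ≤⟨ +-mono-≤ n≤a³ n≤a³ ⟩
      a * a * a + a * a * a   ≡⟨ regroup a ⟩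
      a * a * (2 * a)         ≡⟨ cong (_* (2 * a)) D≡a² ⟨
      D * (2 * a)             ∎
      where open ≤-Reasoning
    narrowLevel = pigeonhole-≤ {D} (2 * a) (λ k → ℓ (suc (toℕ k)) + ℓ (toℕ k)) 1≤D average
    k = proj₁ narrowLevel
    narrow = proj₂ narrowLevel
    k<D = Fin.toℕ<n k
    Sₜ : upper st (toℕ k) t ≡ false
    Sₜ rewrite sink-height I = refl

-- Phase 2: learning edges across minimum cuts of the known graph

module _ {P : Subset n → Set} (P? : ∀ S → Dec (P S)) (c : Subset n → ℕ) where

  -- Exhaustive search is affordable because only queries are counted. Each replacement lowers `c`,
  -- so fuel `c S` is enough.
  descend : ℕ → Subset n → Subset n
  descend zero    S = S
  descend (suc m) S with anySubset? (λ S′ → P? S′ ×-dec (c S′ <? c S))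
  ... | yes (S′ , _) = descend m S′
  ... | no _         = S

  descend-minimal : ∀ m S → P S → c S ≤ m → P (descend m S) × (∀ S′ → P S′ → c (descend m S) ≤ c S′)
  descend-minimal zero    S PS c≤0 = PS , λ S′ _ → ≤-trans c≤0 z≤n
  descend-minimal (suc m) S PS c≤m with anySubset? (λ S′ → P? S′ ×-dec (c S′ <? c S))
  ... | yes (S′ , PS′ , lt) = descend-minimal m S′ PS′ (≤-pred (≤-trans lt c≤m))
  ... | no none             = PS , λ S′ PS′ → ≮⇒≥ (λ lt → none (S′ , PS′ , lt))

Separates : Fin n → Fin n → VertexSet n → Set
Separates s t S = S s ≡ true × S t ≡ false

minimumCut : Fin n → Fin n → Matrix n → Subset n
minimumCut s t K =
  descend (λ S → (lookup S s Bool.≟ true) ×-dec (lookup S t Bool.≟ false)) (∂⁺ K ∘ lookup)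
    (∂⁺ K (lookup (tabulate (single s)))) (tabulate (single s))

minimumCut-correct : {s t : Fin n} → s ≢ t → (K : Matrix n) →
  Separates s t (lookup (minimumCut s t K)) ×
  (∀ S → Separates s t S → ∂⁺ K (lookup (minimumCut s t K)) ≤ ∂⁺ K S)
minimumCut-correct {s = s} {t} s≢t K with descend-minimal
  (λ S → (lookup S s Bool.≟ true) ×-dec (lookup S t Bool.≟ false)) (∂⁺ K ∘ lookup)
  (∂⁺ K (lookup (tabulate (single s)))) (tabulate (single s))
  (trans (lookup∘tabulate (single s) s) (single-refl s) ,
   trans (lookup∘tabulate (single s) t) (single-≢ (s≢t ∘ ≡-sym))) ≤-refl
... | separates , minimal = separates , λ S (Ss , St) → ≤-trans
  (minimal (tabulate S) (trans (lookup∘tabulate S s) Ss , trans (lookup∘tabulate S t) St))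
  (≤-reflexive (∂⁺-cong (lookup∘tabulate S)))

mutual
  refinePhase : Fin n → Fin n → ℕ → Matrix n → Prog n (Subset n)
  refinePhase s t zero    K = return (minimumCut s t K)
  refinePhase s t (suc F) K =
    findUnknown s K (lookup (minimumCut s t K)) (∁ (lookup (minimumCut s t K))) >>= refineFrom s t F K

  refineFrom : Fin n → Fin n → ℕ → Matrix n → Maybe (Fin n × Fin n) → Prog n (Subset n)
  refineFrom s t F K (just (x , y)) = refinePhase s t F (learn x y K)
  refineFrom s t F K nothing        = return (minimumCut s t K)

refinePhase-within : (s t : Fin n) → ∀ F K → refinePhase s t F K within F * findCost n
refinePhase-within s t zero    K = _
refinePhase-within s t (suc F) K = within->>= (findUnknown s K T (∁ T)) (findUnknown-within s K T (∁ T)) λ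
  { (just (x , y)) → refinePhase-within s t F (learn x y K)
  ; nothing        → _ }
  where T = lookup (minimumCut s t K)

-- Edge sets built across small cuts

arcs-learn : (x y : Fin n) (M : Matrix n) (A B : VertexSet n) →
             arcs (learn x y M) A B ≡ arcs M A B + (ι (A x ∧ B y) + ι (A y ∧ B x))
arcs-learn x y M A B = trans (arcs-⊞ M (unit x y ⊞ unit y x) A B)
  (cong (arcs M A B +_) (trans (arcs-⊞ (unit x y) (unit y x) A B)
                               (cong₂ _+_ (arcs-unit x y A B) (arcs-unit y x A B))))

learn-symmetric : (x y : Fin n) {M : Matrix n} → Symmetric M → Symmetric (learn x y M)
learn-symmetric x y M-sym i j = cong₂ _+_ (M-sym i j)
  (trans (+-comm (unit x y i j) (unit y x i j))
         (cong₂ _+_ (*-comm (ι (single y i)) (ι (single x j))) (*-comm (ι (single x i)) (ι (single y j)))))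

size-split : (W T : VertexSet n) → ∣ W ∣ₛ ≡ ∣ W ∩ T ∣ₛ + ∣ W ∩ ∁ T ∣ₛ
size-split W T = trans (sum-cong-≗ λ v → split (W v) (T v)) (∑-distrib-+ (ι ∘ (W ∩ T)) (ι ∘ (W ∩ ∁ T)))
  where
  split : ∀ w t → ι w ≡ ι (w ∧ t) + ι (w ∧ not t)
  split false _     = refl
  split true  false = refl
  split true  true  = refl

-- A pair inside `W` lies within one side of `T` or crosses it; the crossing pairs are bounded by
-- all arcs across `T`, once in each direction.
arcs-split : {M : Matrix n} → Symmetric M → (W T : VertexSet n) →
             arcs M W W ≤ arcs M (W ∩ T) (W ∩ T) + arcs M (W ∩ ∁ T) (W ∩ ∁ T) + 2 * ∂⁺ M T
arcs-split {n} {M} M-sym W T = begin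
  arcs M W W
    ≤⟨ total-mono (λ i j → pointwise (W i) (W j) (T i) (T j) (M i j)) ⟩
  total (λ i j → inner i j + (outer i j + (cross i j + back i j)))
    ≡⟨ trans (total-+ inner _) (cong (total inner +_) (trans (total-+ outer _) (cong (total outer +_) (total-+ cross back)))) ⟩
  total inner + (total outer + (∂⁺ M T + arcs M (∁ T) T))
    ≡⟨ cong (λ e → total inner + (total outer + (∂⁺ M T + e))) (arcs-sym M-sym (∁ T) T) ⟩
  total inner + (total outer + (∂⁺ M T + ∂⁺ M T))
    ≡⟨ regroup (total inner) (total outer) (∂⁺ M T) ⟩
  total inner + total outer + 2 * ∂⁺ M T ∎
  where
  open ≤-Reasoning
  inner outer cross back : Matrix n
  inner i j = ι ((W ∩ T) i ∧ (W ∩ T) j) * M i j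
  outer i j = ι ((W ∩ ∁ T) i ∧ (W ∩ ∁ T) j) * M i j
  cross i j = ι (T i ∧ not (T j)) * M i j
  back  i j = ι (not (T i) ∧ T j) * M i j
  regroup : ∀ a b c → a + (b + (c + c)) ≡ a + b + 2 * c
  regroup = solve-∀
  pointwise : ∀ w w′ t t′ m → ι (w ∧ w′) * m ≤ ι ((w ∧ t) ∧ (w′ ∧ t′)) * m +
    (ι ((w ∧ not t) ∧ (w′ ∧ not t′)) * m + (ι (t ∧ not t′) * m + ι (not t ∧ t′) * m))
  pointwise false w′    t     t′    m = z≤n
  pointwise true  false t     t′    m = z≤n
  pointwise true  true  false false m = m≤m+n _ _
  pointwise true  true  false true  m = ≤-refl
  pointwise true  true  true  false m = m≤m+n _ _
  pointwise true  true  true  true  m = m≤m+n _ _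

-- |W| - 1 appears without subtraction, and the factor 2 is there because arcs counts every edge twice.
Sparse : ℕ → Matrix n → Set
Sparse κ F = ∀ W {w} → W w ≡ true → arcs F W W + 2 * κ ≤ 2 * κ * ∣ W ∣ₛ

-- Only a `W` containing both endpoints gains. Then `T` splits it into two nonempty sparse parts,
-- and the reserve `2 * κ` of one part pays for the edges across `T`: fewer than `κ` old ones and
-- the new one.
learn-sparse : ∀ {κ F} {x y : Fin n} T → Symmetric F → Sparse κ F → T x ≡ true → T y ≡ false →
               ∂⁺ F T < κ → Sparse κ (learn x y F)
learn-sparse {κ = κ} {F} {x} {y} T F-sym sparse Tx Ty small W {w} Ww
  rewrite arcs-learn x y F W W with W x in Wx | W y in Wy
... | false | false rewrite +-identityʳ (arcs F W W) = sparse W Ww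
... | false | true  rewrite +-identityʳ (arcs F W W) = sparse W Ww
... | true  | false rewrite +-identityʳ (arcs F W W) = sparse W Ww
... | true  | true  = begin
  arcs F W W + 2 + 2 * κ
    ≤⟨ +-monoˡ-≤ (2 * κ) (+-monoˡ-≤ 2 (arcs-split F-sym W T)) ⟩
  arcs F (W ∩ T) (W ∩ T) + arcs F (W ∩ ∁ T) (W ∩ ∁ T) + 2 * ∂⁺ F T + 2 + 2 * κ
    ≡⟨ regroup (arcs F (W ∩ T) (W ∩ T)) (arcs F (W ∩ ∁ T) (W ∩ ∁ T)) (∂⁺ F T) (2 * κ) ⟩
  arcs F (W ∩ T) (W ∩ T) + 2 * κ + (arcs F (W ∩ ∁ T) (W ∩ ∁ T) + 2 * suc (∂⁺ F T))
    ≤⟨ +-mono-≤ (sparse (W ∩ T) (∧-intro Wx Tx))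
         (≤-trans (+-monoʳ-≤ _ (*-monoʳ-≤ 2 small)) (sparse (W ∩ ∁ T) (∧-intro Wy (cong not Ty)))) ⟩
  2 * κ * ∣ W ∩ T ∣ₛ + 2 * κ * ∣ W ∩ ∁ T ∣ₛ
    ≡⟨ *-distribˡ-+ (2 * κ) ∣ W ∩ T ∣ₛ ∣ W ∩ ∁ T ∣ₛ ⟨
  2 * κ * (∣ W ∩ T ∣ₛ + ∣ W ∩ ∁ T ∣ₛ)
    ≡⟨ cong (2 * κ *_) (size-split W T) ⟨
  2 * κ * ∣ W ∣ₛ ∎
  where
  open ≤-Reasoning
  regroup : ∀ a b c k → a + b + 2 * c + 2 + k ≡ a + k + (b + 2 * suc c)
  regroup = solve-∀

full : VertexSet n
full _ = true

module RefinePhase (G : Graph n) (s t : Fin n) (s≢t : s ≢ t) (base κ : ℕ)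
                   (S* : VertexSet n) (S*-separates : Separates s t S*)
                   (S*-small : ∂⁺ (adjacency G) S* < base + κ) where

  -- `F` collects the edges learned in phase 2. In `surplus`, `base` accounts for the edges of phase
  -- 1, and `F` comes on top.
  record Learned (K F : Matrix n) : Set where
    field
      isKnown   : KnownSubgraph G K
      F-sym     : Symmetric F
      surplus   : ∀ S → Separates s t S → base + ∂⁺ F S ≤ ∂⁺ K S
      sparse    : Sparse κ F
  open Learned

  refinePhase-correct : ∀ fuel {K F} → Learned K F → 2 * κ * n < 2 * fuel + arcs F full full →
                        IsMinSTCut G s t (eval (refinePhase s t fuel K) (cut G))
  -- Sparsity of the whole vertex set bounds the learned edges, so the fuel cannot have run out.
  refinePhase-correct zero {K} {F} L fuel = contradiction fuel (≤⇒≯ (begin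
    arcs F full full              ≤⟨ m≤m+n _ _ ⟩
    arcs F full full + 2 * κ      ≤⟨ sparse L full {s} refl ⟩
    2 * κ * ∣ full {n} ∣ₛ         ≡⟨ cong (2 * κ *_) (trans (sum-const n 1) (*-identityʳ n)) ⟩
    2 * κ * n                     ∎))
    where open ≤-Reasoning
  refinePhase-correct (suc fuel) {K} {F} L enough
    rewrite eval->>= (findUnknown s K (lookup (minimumCut s t K)) (∁ (lookup (minimumCut s t K))))
                     (refineFrom s t fuel K) (cut G)
    with eval (findUnknown s K (lookup (minimumCut s t K)) (∁ (lookup (minimumCut s t K)))) (cut G)
       | findUnknown-correct (isKnown L) s (lookup (minimumCut s t K)) (∁ (lookup (minimumCut s t K)))
           (λ i → Bool.∧-inverseʳ (lookup (minimumCut s t K) i))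
       | minimumCut-correct s≢t K
  ... | just (x , y) | Tx , ¬Ty , unk | separates , minimal =
    refinePhase-correct fuel learned (subst (2 * κ * n <_) refuel enough)
    where
    T = lookup (minimumCut s t K)
    Ty : T y ≡ false
    Ty = Bool.not-injective ¬Ty
    -- `T` is minimum in `K`, so it weighs less than `base + κ` there; `base` of this is due to
    -- phase 1, leaving fewer than `κ` edges of `F`.
    small : ∂⁺ F T < κ
    small = +-cancelˡ-< base _ _ (begin-strict
      base + ∂⁺ F T       ≤⟨ surplus L T separates ⟩
      ∂⁺ K T              ≤⟨ minimal S* S*-separates ⟩
      ∂⁺ K S*             ≤⟨ arcs-mono (bounded (isKnown L)) S* (∁ S*) ⟩
      ∂⁺ (adjacency G) S* <⟨ S*-small ⟩
      base + κ            ∎)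
      where open ≤-Reasoning
    surplus′ : ∀ S → Separates s t S → base + ∂⁺ (learn x y F) S ≤ ∂⁺ (learn x y K) S
    surplus′ S sep rewrite arcs-learn x y F S (∁ S) | arcs-learn x y K S (∁ S)
      | ≡-sym (+-assoc base (∂⁺ F S) (ι (S x ∧ not (S y)) + ι (S y ∧ not (S x))))
      = +-monoˡ-≤ _ (surplus L S sep)
    learned : Learned (learn x y K) (learn x y F)
    learned = record
      { isKnown = learn-known (isKnown L) unk
      ; F-sym   = learn-symmetric x y (F-sym L)
      ; surplus = surplus′
      ; sparse  = learn-sparse T (F-sym L) (sparse L) Tx Ty small }
    refuel : 2 * suc fuel + arcs F full full ≡ 2 * fuel + arcs (learn x y F) full full
    refuel rewrite arcs-learn x y F full full = shift fuel (arcs F full full)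
      where
      shift : ∀ a b → 2 * suc a + b ≡ 2 * a + (b + 2)
      shift = solve-∀
  ... | nothing | none | (Ts , Tt) , minimal =
    lookup⇒[]= s _ Ts , (λ t∈T → contradiction (trans (≡-sym Tt) ([]=⇒lookup t∈T)) λ ()) , optimal
    where
    T = lookup (minimumCut s t K)
    -- The failed search shows that `K` and `G` agree across `T`; as `K` lies below `G`, a minimum
    -- cut of `K` is then one of `G`.
    all-known : ∂⁺ (adjacency G) T ≤ ∂⁺ K T
    all-known = total-mono pointwise
      where
      pointwise : ∀ i j → ι (T i ∧ not (T j)) * adjacency G i j ≤ ι (T i ∧ not (T j)) * K i j
      pointwise i j with T i in Ti | T j in Tj
      ... | false | _     = z≤n
      ... | true  | true  = z≤n
      ... | true  | false = +-monoˡ-≤ 0 (≮⇒≥ (none Ti (cong not Tj)))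
    optimal : ∀ S → s ∈ S → t ∉ S → cut G (minimumCut s t K) ≤ cut G S
    optimal S s∈S t∉S = begin
      cut G (minimumCut s t K)     ≡⟨ cut≡∂⁺ G (minimumCut s t K) ⟩
      ∂⁺ (adjacency G) T           ≤⟨ all-known ⟩
      ∂⁺ K T                       ≤⟨ minimal (lookup S) ([]=⇒lookup s∈S , Bool.¬-not (t∉S ∘ lookup⇒[]= t S)) ⟩
      ∂⁺ K (lookup S)              ≤⟨ arcs-mono (bounded (isKnown L)) (lookup S) (∁ (lookup S)) ⟩
      ∂⁺ (adjacency G) (lookup S)  ≡⟨ cut≡∂⁺ G S ⟨
      cut G S                      ∎
      where open ≤-Reasoning

-- The algorithm and its cost

⌈cbrt_⌉ : ℕ → ℕ
⌈cbrt zero ⌉  = 0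
⌈cbrt suc n ⌉ with suc n ≤? ⌈cbrt n ⌉ * ⌈cbrt n ⌉ * ⌈cbrt n ⌉
... | yes _ = ⌈cbrt n ⌉
... | no _  = suc ⌈cbrt n ⌉

⌈cbrt⌉-upper : ∀ n → n ≤ ⌈cbrt n ⌉ * ⌈cbrt n ⌉ * ⌈cbrt n ⌉
⌈cbrt⌉-upper zero = z≤n
⌈cbrt⌉-upper (suc n) with suc n ≤? ⌈cbrt n ⌉ * ⌈cbrt n ⌉ * ⌈cbrt n ⌉
... | yes p = p
... | no _  = begin
  suc n                 ≤⟨ s≤s (⌈cbrt⌉-upper n) ⟩
  suc (a * a * a)       ≤⟨ s≤s (m≤m+n _ (3 * (a * a) + 3 * a)) ⟩
  suc (a * a * a + (3 * (a * a) + 3 * a)) ≡⟨ expand a ⟩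
  suc a * suc a * suc a ∎
  where
  open ≤-Reasoning
  a = ⌈cbrt n ⌉
  expand : ∀ a → suc (a * a * a + (3 * (a * a) + 3 * a)) ≡ suc a * suc a * suc a
  expand = solve-∀

-- The root grows only when its old cube is below the new argument, and `suc a ≤ 2 * a` for a
-- positive root `a` costs the factor 8.
⌈cbrt⌉-lower : ∀ n → ⌈cbrt n ⌉ * ⌈cbrt n ⌉ * ⌈cbrt n ⌉ ≤ 8 * n
⌈cbrt⌉-lower zero = z≤n
⌈cbrt⌉-lower (suc n) with suc n ≤? ⌈cbrt n ⌉ * ⌈cbrt n ⌉ * ⌈cbrt n ⌉
... | yes _ = ≤-trans (⌈cbrt⌉-lower n) (*-monoʳ-≤ 8 (n≤1+n n))
... | no ¬p = next ⌈cbrt n ⌉ (<⇒≤ (≰⇒> ¬p))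
  where
  open ≤-Reasoning
  cube : ∀ a → (2 * a) * (2 * a) * (2 * a) ≡ 8 * (a * a * a)
  cube = solve-∀
  next : ∀ a → a * a * a ≤ suc n → suc a * suc a * suc a ≤ 8 * suc n
  next zero      _    = s≤s z≤n
  next a@(suc b) a³≤n = begin
    suc a * suc a * suc a              ≤⟨ *-mono-≤ (*-mono-≤ double double) double ⟩
    (2 * a) * (2 * a) * (2 * a)        ≡⟨ cube a ⟩
    8 * (a * a * a)                    ≤⟨ *-monoʳ-≤ 8 a³≤n ⟩
    8 * suc n                          ∎
    where
    double : suc a ≤ 2 * a
    double = +-mono-≤ {1} {a} (s≤s z≤n) (≤-reflexive (≡-sym (+-identityʳ a)))

levels : ℕ → ℕ
levels n = ⌈cbrt n ⌉ * ⌈cbrt n ⌉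

-- The slack `κ` of phase 2: the cut of `small-cut` exceeds the tokens at `t` by at most
-- `1 + 2 * levels n`, and the strict inequality takes one more.
deficit : ℕ → ℕ
deficit n = 2 + 2 * levels n

-- One more than `maxPotential`, as `pushPhase-correct` asks for a strict inequality.
pushFuel : ℕ → ℕ
pushFuel n = suc (2 * (n * levels n) + suc (levels n) * n)

refineFuel : ℕ → ℕ
refineFuel n = suc (deficit n * n)

minCutProgram : Fin n → Fin n → Prog n (Subset n)
minCutProgram {n} s t =
  pushPhase s t (levels n) (pushFuel n) (start s) >>= λ st →
  refinePhase s t (refineFuel n) (known st)

minCutProgram-within : (s t : Fin n) →
  minCutProgram s t within (pushFuel n * (findCost n + 0) + refineFuel n * findCost n)
minCutProgram-within {n} s t = within->>= (pushPhase s t (levels n) (pushFuel n) (start s))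
  (pushPhase-within s t (levels n) (pushFuel n) (start s)) (λ st → refinePhase-within s t (refineFuel n) (known st))

minCutProgram-correct : (G : Graph n) (s t : Fin n) → s ≢ t →
                        IsMinSTCut G s t (eval (minCutProgram s t) (cut G))
minCutProgram-correct {n} G s t s≢t
  rewrite eval->>= (pushPhase s t (levels n) (pushFuel n) (start s))
                   (λ st → refinePhase s t (refineFuel n) (known st)) (cut G)
  = refinePhase-correct (refineFuel n) nothing-learned enough
  where
  open PushPhase G s t s≢t (levels n)
  a = ⌈cbrt n ⌉
  st = eval (pushPhase s t (levels n) (pushFuel n) (start s)) (cut G)
  pushed-all : Invariant st × levels n ≤ height st s
  pushed-all = pushPhase-correct (pushFuel n) start-invariant
    (≤-trans (≤-reflexive (cong suc (+-identityʳ maxPotential))) (m≤m+n (suc maxPotential) (potential (start s))))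
  I = proj₁ pushed-all
  1≤n : 1 ≤ n
  1≤n = ≤-trans (s≤s z≤n) (Fin.toℕ<n s)
  positive : ∀ a → 1 ≤ a * a * a → 1 ≤ a * a
  positive (suc a) _ = s≤s z≤n
  nearly = small-cut I (proj₂ pushed-all) a (positive a (≤-trans 1≤n (⌈cbrt⌉-upper n))) refl (⌈cbrt⌉-upper n)
  S* = proj₁ nearly
  S*-small : ∂⁺ (adjacency G) S* < parked st t + deficit n
  S*-small = ≤-trans (s≤s (proj₂ (proj₂ (proj₂ nearly)))) (≤-reflexive (regroup (parked st t) (2 * (a * a))))
    where
    regroup : ∀ p q → suc (p + 1 + q) ≡ p + (2 + q)
    regroup = solve-∀
  open RefinePhase G s t s≢t (parked st t) (deficit n) S*
    (proj₁ (proj₂ nearly) , proj₁ (proj₂ (proj₂ nearly))) S*-small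
  nothing-learned : Learned (known st) (λ _ _ → 0)
  nothing-learned = record
    { isKnown = Invariant.isKnown I
    ; F-sym   = λ _ _ → refl
    ; surplus = λ S (Ss , St) → ≤-trans
        (≤-reflexive (trans (cong (parked st t +_) (arcs-zero S (∁ S))) (+-identityʳ _)))
        (parked-sink≤∂⁺ I S Ss St)
    ; sparse  = λ W {w} Ww → ≤-trans
        (≤-reflexive (trans (cong (_+ 2 * deficit n) (arcs-zero W W)) (≡-sym (*-identityʳ (2 * deficit n)))))
        (*-monoʳ-≤ (2 * deficit n) (≤-trans (≤-reflexive (≡-sym (cong ι Ww))) (term≤sum (ι ∘ W) w))) }
  enough : 2 * deficit n * n < 2 * refineFuel n + arcs {n} (λ _ _ → 0) full full
  enough = ≤-trans (≤-trans (s≤s (n≤1+n _)) (≤-reflexive (≡-sym (expand (deficit n) n)))) (m≤m+n (2 * refineFuel n) _)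
    where
    expand : ∀ d n → 2 * suc (d * n) ≡ 2 + 2 * d * n
    expand = solve-∀

-- From `2 ≤ n`, both `levels n` and `⌈log₂ n ⌉` are positive and absorb the additive constants: at
-- most `10 * (n * levels n)` searches of at most `9 * ⌈log₂ n ⌉` queries.
cost-bound : ∀ n → 2 ≤ n → pushFuel n * (findCost n + 0) + refineFuel n * findCost n ≤
                           90 * (n * levels n * ⌈log₂ n ⌉)
cost-bound n 2≤n = begin
  pushFuel n * (findCost n + 0) + refineFuel n * findCost n
    ≡⟨ collect n D (findCost n) ⟩
  (2 + 3 * n + 5 * (n * D)) * findCost n
    ≤⟨ *-mono-≤ {2 + 3 * n + 5 * (n * D)} fuel find ⟩
  (10 * (n * D)) * (9 * L)
    ≡⟨ product n D L ⟩
  90 * (n * D * L) ∎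
  where
  open ≤-Reasoning
  D = levels n
  L = ⌈log₂ n ⌉
  collect : ∀ n D c → suc (2 * (n * D) + suc D * n) * (c + 0) + suc ((2 + 2 * D) * n) * c ≡
                      (2 + 3 * n + 5 * (n * D)) * c
  collect = solve-∀
  product : ∀ n D L → (10 * (n * D)) * (9 * L) ≡ 90 * (n * D * L)
  product = solve-∀
  1≤L : 1 ≤ L
  1≤L = ≤-trans (≤-reflexive (≡-sym (⌈log₂2^n⌉≡n 1))) (⌈log₂⌉-mono-≤ 2≤n)
  1≤D : ∀ a → n ≤ a * a * a → 1 ≤ a * a
  1≤D zero    n≤0 = contradiction (≤-trans 2≤n n≤0) λ ()
  1≤D (suc a) _   = s≤s z≤n
  n≤nD : n ≤ n * D
  n≤nD = ≤-trans (≤-reflexive (≡-sym (*-identityʳ n))) (*-monoʳ-≤ n (1≤D ⌈cbrt n ⌉ (⌈cbrt⌉-upper n)))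
  fuel : 2 + 3 * n + 5 * (n * D) ≤ 10 * (n * D)
  fuel = begin
    2 + 3 * n + 5 * (n * D)              ≤⟨ +-monoˡ-≤ _ (+-mono-≤ (≤-trans 2≤n n≤nD) (*-monoʳ-≤ 3 n≤nD)) ⟩
    n * D + 3 * (n * D) + 5 * (n * D)    ≤⟨ m≤m+n _ (n * D) ⟩
    n * D + 3 * (n * D) + 5 * (n * D) + n * D ≡⟨ ten (n * D) ⟩
    10 * (n * D)                         ∎
    where
    ten : ∀ x → x + 3 * x + 5 * x + x ≡ 10 * x
    ten = solve-∀
  find : findCost n ≤ 9 * L
  find = begin
    3 + (L * 3 + (L * 3 + 0))       ≤⟨ +-monoˡ-≤ _ (*-monoʳ-≤ 3 1≤L) ⟩
    3 * L + (L * 3 + (L * 3 + 0))   ≡⟨ nine L ⟩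
    9 * L                           ∎
    where
    nine : ∀ L → 3 * L + (L * 3 + (L * 3 + 0)) ≡ 9 * L
    nine = solve-∀

-- The cube of `levels n` is the sixth power of the root, at most `(8 * n) ^ 2`; this gives the 64
-- and turns `n ^ 3` into `n ^ 5`.
cost-cubed : ∀ c n → (c * (n * levels n * ⌈log₂ n ⌉)) ^ 3 ≤ c ^ 3 * 64 * n ^ 5 * ⌈log₂ n ⌉ ^ 3
cost-cubed c n = begin
  (c * (n * (a * a) * L)) ^ 3                       ≡⟨ separate c n a L ⟩
  c ^ 3 * (a * a * a * (a * a * a)) * n ^ 3 * L ^ 3 ≤⟨ *-monoˡ-≤ (L ^ 3) (*-monoˡ-≤ (n ^ 3) (*-monoʳ-≤ (c ^ 3)
                                                         (*-mono-≤ (⌈cbrt⌉-lower n) (⌈cbrt⌉-lower n)))) ⟩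
  c ^ 3 * (8 * n * (8 * n)) * n ^ 3 * L ^ 3         ≡⟨ recombine (c ^ 3) n (L ^ 3) ⟩
  c ^ 3 * 64 * n ^ 5 * L ^ 3                        ∎
  where
  open ≤-Reasoning
  a = ⌈cbrt n ⌉
  L = ⌈log₂ n ⌉
  -- Powers are spelled out because the ring solver does not recognise _^_ on ℕ.
  separate : ∀ c n a L → let x = c * (n * (a * a) * L) in
    x * (x * (x * 1)) ≡ c * (c * (c * 1)) * (a * a * a * (a * a * a)) * (n * (n * (n * 1))) * (L * (L * (L * 1)))
  separate = solve-∀
  recombine : ∀ c n l → c * (8 * n * (8 * n)) * (n * (n * (n * 1))) * l ≡
                        c * 64 * (n * (n * (n * (n * (n * 1))))) * l
  recombine = solve-∀

minCutAlgorithm : Algorithm (λ _ → 0)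
minCutAlgorithm n s t _ = toTree (minCutProgram s t)

minCutAlgorithm-queries : QueryBound minCutAlgorithm
minCutAlgorithm-queries = 90 ^ 3 * 64 , 3 , 2 , λ n 2≤n G s t _ _ → ≤-trans
  (^-monoˡ-≤ 3 (≤-trans (run-toTree-cost (minCutProgram s t) (cut G) (minCutProgram-within s t)) (cost-bound n 2≤n)))
  (cost-cubed 90 n)

minCutAlgorithm-correct : HighProbCorrect minCutAlgorithm
-- Without random bits the empty string is the only one, and it is good; the failure count is
-- `1 ∸ 1`, so both exponents can be 1.
minCutAlgorithm-correct = 1 , 1 , 0 , ≤-refl , ≤-refl , λ n _ G s t s≢t →
  Vec.[] List.∷ List.[] ,
  All.[] AllPairs.∷ AllPairs.[] ,
  subst (IsMinSTCut G s t) (≡-sym (run-toTree-output (minCutProgram s t) (cut G)))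
        (minCutProgram-correct G s t s≢t) All.∷ All.[] ,
  z≤n

theorem1p2 : Σ[ m ∈ (ℕ → ℕ) ] Σ[ A ∈ Algorithm m ] QueryBound A × HighProbCorrect A
theorem1p2 = (λ _ → 0) , minCutAlgorithm , minCutAlgorithm-queries , minCutAlgorithm-correct
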